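{- If $G$ is a finite, simple, connected graph other than $C_3$, $C_4$, $C_5$ or $K_{1,3}$, then there exists $K$ such that for all $k \geq K$ we have $D(L^k(G)) \leq 2$.
   Context: For a finite graph $G$, a map $f:V(G) \to \{1,\dotsc,k\}$ distinguishes $G$ if for every nontrivial automorphism $\phi$ of $G$ there is a vertex $v$ with $f(v) \neq f(\phi(v))$. The distinguishing number $D(G)$ is the least $k$ for which such a map exists. The line graph $L(G)$ has vertex set $E(G)$, two edges adjacent if they share an endpoint; $L^k(G) = L(L^{k-1}(G))$, $L^0(G)=G$. -}

module Defs where

open import Data.Nat using (ℕ; zero; suc; _+_; _≡ᵇ_)
open import Data.Nat.DivMod using (_%_)
open import Data.Bool using (Bool; true; false; _∧_; _∨_; not)
open import Data.Fin using (Fin; toℕ; _<?_) renaming (_≟_ to _≟ᶠ_)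
open import Data.Fin.Permutation using (Permutation; Permutation′; _⟨$⟩ʳ_)
open import Data.List using (List; []; _∷_; length; lookup; allFin; concatMap; filterᵇ; map)
open import Data.Product using (_×_; _,_; proj₁; proj₂; ∃; Σ)
open import Relation.Nullary.Decidable using (⌊_⌋)
open import Relation.Binary.PropositionalEquality using (_≡_; _≢_)
open import Relation.Binary.Construct.Closure.ReflexiveTransitive using (Star)

record Graph : Set where
  constructor mkGraph
  field
    n   : ℕ
    adj : Fin n → Fin n → Bool
open Graph public

IsSimple : Graph → Set
IsSimple G = (∀ i j → adj G i j ≡ adj G j i) × (∀ i → adj G i i ≡ false)

Connected : Graph → Set
Connected G = ∀ i j → Star (λ a b → adj G a b ≡ true) i j

_==_ : ∀ {m} → Fin m → Fin m → Bool
i == j = ⌊ i ≟ᶠ j ⌋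

edges : (G : Graph) → List (Fin (n G) × Fin (n G))
edges G = filterᵇ (λ p → ⌊ proj₁ p <? proj₂ p ⌋ ∧ adj G (proj₁ p) (proj₂ p))
            (concatMap (λ i → map (λ j → i , j) (allFin (n G))) (allFin (n G)))

shareEnd : ∀ {m} → Fin m × Fin m → Fin m × Fin m → Bool
shareEnd (a , b) (c , d) = (a == c) ∨ (a == d) ∨ (b == c) ∨ (b == d)

L : Graph → Graph
L G = mkGraph (length (edges G))
        (λ e f → not (e == f) ∧ shareEnd (lookup (edges G) e) (lookup (edges G) f))

L^ : ℕ → Graph → Graph
L^ zero    G = G
L^ (suc k) G = L (L^ k G)

IsAut : (G : Graph) → Permutation′ (n G) → Set
IsAut G π = ∀ i j → adj G (π ⟨$⟩ʳ i) (π ⟨$⟩ʳ j) ≡ adj G i j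

Nontrivial : ∀ {m} → Permutation′ m → Set
Nontrivial π = ∃ λ v → π ⟨$⟩ʳ v ≢ v

Distinguishes : (G : Graph) {k : ℕ} → (Fin (n G) → Fin k) → Set
Distinguishes G f = ∀ (π : Permutation′ (n G)) → IsAut G π → Nontrivial π →
                    ∃ λ v → f v ≢ f (π ⟨$⟩ʳ v)

-- D(G) ≤ k  iff some distinguishing map into k colours exists (D is the least such k).
D≤ : Graph → ℕ → Set
D≤ G k = Σ (Fin (n G) → Fin k) (Distinguishes G)

Isomorphic : Graph → Graph → Set
Isomorphic G H = Σ (Permutation (n G) (n H)) λ σ →
                 ∀ i j → adj H (σ ⟨$⟩ʳ i) (σ ⟨$⟩ʳ j) ≡ adj G i j

C : ℕ → Graph
C zero    = mkGraph zero (λ _ _ → false)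
C (suc m) = mkGraph (suc m)
  (λ i j → (((toℕ i + 1) % suc m) ≡ᵇ toℕ j) ∨ (((toℕ j + 1) % suc m) ≡ᵇ toℕ i))

K13 : Graph
K13 = mkGraph 4 (λ i j → not (i == j) ∧ ((toℕ i ≡ᵇ 0) ∨ (toℕ j ≡ᵇ 0)))

{-# OPTIONS --safe #-}
-- If G has a vertex of degree at least 3 and is not K₁,₃, then passing to L² brings every
-- vertex closer to the vertices of degree at least 3, until the minimum degree is at least 3,
-- and then at least 4. Let H be an iterated line graph of G with minimum degree at least 4.
-- By Whitney's theorem automorphisms of L H come from automorphisms of H, so sending a vertex
-- of L² H, a path with two edges, to its centre in H is equivariant. The fibres of the
-- resulting map from L²ʲ H to H have more than j points; once j is at least the number of
-- vertices of H, colour exactly i points red in the fibre over the i-th vertex. A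
-- colour-preserving automorphism then induces the identity on H, and so it is trivial. Taking
-- both H and L H as the base covers all large exponents. If G has no vertex of degree 3, a
-- maximal trail shows that it is a path, which vanishes, or a cycle, which L preserves.
module Submission where

open import Defs
open import Data.Nat using (ℕ; zero; suc; _+_; _*_; _≤_; _<_; _≥_; _⊔_; z≤n; s≤s)
import Data.Nat.Properties as ℕ
open import Data.Bool using (Bool; true; false; T; _∧_; not)
open import Data.Bool.Properties using (T-≡; T-∧; T-∨; T?)
import Data.Bool.Properties as Bool
open import Data.Fin using (Fin; zero; suc; toℕ; fromℕ; inject₁; opposite; punchIn; splitAt; join; _<?_; inject≤; fromℕ<; _≟_)
import Data.Fin.Properties as Fin
open import Data.Fin.Permutation using (Permutation′; permutation; _⟨$⟩ʳ_; _⟨$⟩ˡ_; inverseˡ; inverseʳ)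
open import Data.List using (List; []; _∷_; lookup; allFin; concatMap; map; cartesianProduct; _++_)
open import Data.List.Membership.Propositional using (_∈_)
open import Data.List.Membership.Propositional.Properties using (∈-lookup; ∈-filter⁺; ∈-filter⁻; ∈-cartesianProduct⁺; ∈-allFin)
open import Data.List.Relation.Unary.Any using (index)
open import Data.List.Relation.Unary.Any.Properties using (lookup-index)
import Data.List.Relation.Unary.All as All
open import Data.List.Relation.Unary.AllPairs using (_∷_)
open import Data.List.Relation.Unary.Unique.Propositional using (Unique)
import Data.List.Relation.Unary.Unique.Propositional.Properties as Unique
open import Data.Product using (_×_; _,_; proj₁; proj₂; ∃; ∃-syntax; Σ)
open import Data.Sum using (_⊎_; inj₁; inj₂; [_,_])
open import Data.Empty using (⊥; ⊥-elim)
open import Function using (_∘_; id)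
open import Function.Bundles using (Equivalence)
open import Function.Definitions using (Injective)
open import Relation.Nullary using (¬_; Dec; yes; no; contradiction)
open import Relation.Nullary.Decidable using (toWitness; fromWitness; ⌊_⌋; _×-dec_; _⊎-dec_; _→-dec_; ¬?; from-yes)
open import Relation.Binary.Definitions using (tri<; tri≈; tri>)
open import Relation.Binary.Construct.Closure.ReflexiveTransitive using (Star; ε; _◅_)
open import Relation.Binary.PropositionalEquality hiding ([_])

-- Degree 4 is what makes Whitney's theorem short. The edges at a vertex then form a clique of at
-- least four in the line graph, and four pairwise adjacent edges must share a vertex, whereas three
-- may bound a triangle. The tower is descended two levels at a time because a vertex of `L G` is an
-- edge, whose ends can be exchanged by an automorphism, while a path with two edges has a canonical
-- middle. This is what splits the exponents by parity. The distance to vertices of degree at least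
-- 3 is likewise followed over two steps: a path between two such vertices loses only one edge per
-- line graph, so the distance from its middle drops only every other time. The claw is excluded
-- because its line graph is a triangle, in which the vertex of degree 3 is lost. The local
-- condition `NoClaw` expresses this, and it holds in every line graph, so it is imposed on the
-- initial graph alone.

V : Graph → Set
V G = Fin (n G)

Adj : (G : Graph) → V G → V G → Set
Adj G u v = adj G u v ≡ true

-- Edges, incidence and line graphs.

lookup-injective : ∀ {A : Set} {xs : List A} → Unique xs → Injective _≡_ _≡_ (lookup xs)
lookup-injective (_ ∷ _)    {zero}  {zero}  _  = refl
lookup-injective (x∉ ∷ _)   {zero}  {suc j} eq = contradiction eq (All.lookup x∉ (∈-lookup j))
lookup-injective (x∉ ∷ _)   {suc i} {zero}  eq = contradiction (sym eq) (All.lookup x∉ (∈-lookup i))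
lookup-injective (_ ∷ uniq) {suc i} {suc j} eq = cong suc (lookup-injective uniq eq)

concatMap-cartesianProduct : ∀ {A B : Set} (xs : List A) (ys : List B) →
  concatMap (λ x → map (x ,_) ys) xs ≡ cartesianProduct xs ys
concatMap-cartesianProduct []       ys = refl
concatMap-cartesianProduct (x ∷ xs) ys = cong (map (x ,_) ys ++_) (concatMap-cartesianProduct xs ys)

==⇒≡ : ∀ {m} {i j : Fin m} → T (i == j) → i ≡ j
==⇒≡ = toWitness

≡⇒== : ∀ {m} {i j : Fin m} → i ≡ j → T (i == j)
≡⇒== = fromWitness

T-not : ∀ {x} → ¬ T x → T (not x)
T-not {true}  h = h _
T-not {false} _ = _

T-not⁻ : ∀ {x} → T (not x) → ¬ T x
T-not⁻ {false} _ ()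

adj-sym : ∀ {G} → IsSimple G → ∀ {u v} → Adj G u v → Adj G v u
adj-sym simple a = trans (sym (proj₁ simple _ _)) a

adj-irrefl : ∀ {G} → IsSimple G → ∀ {u v} → Adj G u v → u ≢ v
adj-irrefl simple a refl with trans (sym a) (proj₂ simple _)
... | ()

-- `edges` stores each edge with its smaller end first. Membership of both `u` and `v` together with
-- `distinct` allows them in either order.
record Edge {A : Set} (a b : A) (u v : A) : Set where
  constructor joins
  field
    inc₁     : u ≡ a ⊎ u ≡ b
    inc₂     : v ≡ a ⊎ v ≡ b
    distinct : u ≢ v
open Edge

-- The arguments below see line graphs only through this interface: the unfolded L (L G) is huge.
record Line (G H : Graph) : Set where
  field
    simple   : IsSimple G
    L-simple : IsSimple H
    fst snd  : V H → V G

  Inc : V G → V H → Set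
  Inc v e = v ≡ fst e ⊎ v ≡ snd e

  Joins : V H → V G → V G → Set
  Joins e = Edge (fst e) (snd e)

  field
    joins-ends   : ∀ e → Joins e (fst e) (snd e)
    joins-unique : ∀ {e f u v} → Joins e u v → Joins f u v → e ≡ f
    L-adj⁺       : ∀ {e f v} → e ≢ f → Inc v e → Inc v f → Adj H e f
    L-adj⁻       : ∀ {e f} → Adj H e f → e ≢ f × ∃[ v ] Inc v e × Inc v f
    adj⇒joins    : ∀ {u v} → Adj G u v → ∃[ e ] Joins e u v
    joins⇒adj    : ∀ {e u v} → Joins e u v → Adj G u v

  joins-sym : ∀ {e u v} → Joins e u v → Joins e v u
  joins-sym (joins p q u≢v) = joins q p (u≢v ∘ sym)

  joins-only : ∀ {e u v w} → Joins e u v → Inc w e → w ≡ u ⊎ w ≡ v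
  joins-only (joins (inj₁ p) (inj₁ q) u≢v) _        = contradiction (trans p (sym q)) u≢v
  joins-only (joins (inj₁ p) (inj₂ q) u≢v) (inj₁ r) = inj₁ (trans r (sym p))
  joins-only (joins (inj₁ p) (inj₂ q) u≢v) (inj₂ r) = inj₂ (trans r (sym q))
  joins-only (joins (inj₂ p) (inj₁ q) u≢v) (inj₁ r) = inj₂ (trans r (sym q))
  joins-only (joins (inj₂ p) (inj₁ q) u≢v) (inj₂ r) = inj₁ (trans r (sym p))
  joins-only (joins (inj₂ p) (inj₂ q) u≢v) _        = contradiction (trans p (sym q)) u≢v

  inc⇒joins : ∀ {e v} → Inc v e → ∃[ u ] Joins e v u
  inc⇒joins {e} (inj₁ refl) = snd e , joins-ends e
  inc⇒joins {e} (inj₂ refl) = fst e , joins-sym (joins-ends e)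

  common-unique : ∀ {e f u v} → e ≢ f → Inc u e → Inc u f → Inc v e → Inc v f → u ≡ v
  common-unique {u = u} {v} e≢f ue uf ve vf with u ≟ v
  ... | yes eq = eq
  ... | no u≢v = contradiction (joins-unique (joins ue ve u≢v) (joins uf vf u≢v)) e≢f

  fork-distinct : ∀ {e f u v w} → Joins e u v → Joins f u w → v ≢ w → e ≢ f
  fork-distinct j k v≢w refl with joins-only j (inc₂ k)
  ... | inj₁ w≡u = distinct k (sym w≡u)
  ... | inj₂ w≡v = v≢w (sym w≡v)

  fork-adj : ∀ {e f u v w} → Joins e u v → Joins f u w → v ≢ w → Adj H e f
  fork-adj j k v≢w = L-adj⁺ (fork-distinct j k v≢w) (inc₁ j) (inc₁ k)

  adj-fork : ∀ {e f} → Adj H e f → ∃[ v ] ∃[ u ] ∃[ w ] Joins e v u × Joins f v w × u ≢ w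
  adj-fork a with L-adj⁻ a
  ... | e≢f , v , i , j with inc⇒joins i | inc⇒joins j
  ... | u , p | w , q = v , u , w , p , q , λ { refl → e≢f (joins-unique p q) }

module LineOf (G : Graph) where

  isEdge : V G × V G → Bool
  isEdge p = ⌊ proj₁ p <? proj₂ p ⌋ ∧ adj G (proj₁ p) (proj₂ p)

  pairs : List (V G × V G)
  pairs = concatMap (λ i → map (λ j → i , j) (allFin (n G))) (allFin (n G))

  edges-unique : Unique (edges G)
  edges-unique = Unique.filter⁺ (T? ∘ isEdge) (subst Unique
    (sym (concatMap-cartesianProduct (allFin (n G)) (allFin (n G))))
    (Unique.cartesianProduct⁺ (Unique.allFin⁺ (n G)) (Unique.allFin⁺ (n G))))

  ∈-edges⁺ : ∀ {u v} → toℕ u < toℕ v → Adj G u v → (u , v) ∈ edges G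
  ∈-edges⁺ {u} {v} u<v uv = ∈-filter⁺ (T? ∘ isEdge)
    (subst ((u , v) ∈_) (sym (concatMap-cartesianProduct (allFin (n G)) (allFin (n G))))
      (∈-cartesianProduct⁺ (∈-allFin u) (∈-allFin v)))
    (Equivalence.from T-∧ (fromWitness u<v , Equivalence.from T-≡ uv))

  fst snd : V (L G) → V G
  fst e = proj₁ (lookup (edges G) e)
  snd e = proj₂ (lookup (edges G) e)

  fst<snd×adj : ∀ e → toℕ (fst e) < toℕ (snd e) × Adj G (fst e) (snd e)
  fst<snd×adj e with Equivalence.to T-∧ (proj₂ (∈-filter⁻ (T? ∘ isEdge) {xs = pairs} (∈-lookup {xs = edges G} e)))
  ... | lt , a = toWitness lt , Equivalence.to T-≡ a

  fst-snd-injective : ∀ {e f} → fst e ≡ fst f → snd e ≡ snd f → e ≡ f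
  fst-snd-injective p q = lookup-injective edges-unique (cong₂ _,_ p q)

  Inc : V G → V (L G) → Set
  Inc v e = v ≡ fst e ⊎ v ≡ snd e

  Joins : V (L G) → V G → V G → Set
  Joins e = Edge (fst e) (snd e)

  joins-ends : ∀ e → Joins e (fst e) (snd e)
  joins-ends e = joins (inj₁ refl) (inj₂ refl) λ eq →
    ℕ.<-irrefl (cong toℕ eq) (proj₁ (fst<snd×adj e))

  joins-ends′ : ∀ {e u v} → Joins e u v →
    (u ≡ fst e × v ≡ snd e) ⊎ (u ≡ snd e × v ≡ fst e)
  joins-ends′ (joins (inj₁ p) (inj₁ q) u≢v) = contradiction (trans p (sym q)) u≢v
  joins-ends′ (joins (inj₁ p) (inj₂ q) u≢v) = inj₁ (p , q)
  joins-ends′ (joins (inj₂ p) (inj₁ q) u≢v) = inj₂ (p , q)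
  joins-ends′ (joins (inj₂ p) (inj₂ q) u≢v) = contradiction (trans p (sym q)) u≢v

  joins-unique : ∀ {e f u v} → Joins e u v → Joins f u v → e ≡ f
  joins-unique {e} {f} j k with joins-ends′ j | joins-ends′ k
  ... | inj₁ (p , q) | inj₁ (p′ , q′) = fst-snd-injective (trans (sym p) p′) (trans (sym q) q′)
  ... | inj₂ (p , q) | inj₂ (p′ , q′) = fst-snd-injective (trans (sym q) q′) (trans (sym p) p′)
  -- Both stored pairs are increasing, so opposite orientations contradict each other.
  ... | inj₁ (p , q) | inj₂ (p′ , q′) = contradiction (proj₁ (fst<snd×adj f))
    (ℕ.<-asym (subst₂ (λ x y → toℕ x < toℕ y) (trans (sym p) p′) (trans (sym q) q′) (proj₁ (fst<snd×adj e))))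
  ... | inj₂ (p , q) | inj₁ (p′ , q′) = contradiction (proj₁ (fst<snd×adj f))
    (ℕ.<-asym (subst₂ (λ x y → toℕ x < toℕ y) (trans (sym q) q′) (trans (sym p) p′) (proj₁ (fst<snd×adj e))))

  L-adj⁺ : ∀ {e f v} → e ≢ f → Inc v e → Inc v f → Adj (L G) e f
  L-adj⁺ {e} {f} e≢f i j = Equivalence.to T-≡ (Equivalence.from T-∧
    (T-not (e≢f ∘ ==⇒≡) , share i j))
    where
    share : ∀ {v} → Inc v e → Inc v f → T (shareEnd (lookup (edges G) e) (lookup (edges G) f))
    share (inj₁ p) (inj₁ q) = Equivalence.from T-∨ (inj₁ (≡⇒== (trans (sym p) q)))
    share (inj₁ p) (inj₂ q) = Equivalence.from (T-∨ {fst e == fst f}) (inj₂ (Equivalence.from T-∨ (inj₁ (≡⇒== (trans (sym p) q)))))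
    share (inj₂ p) (inj₁ q) = Equivalence.from (T-∨ {fst e == fst f}) (inj₂ (Equivalence.from (T-∨ {fst e == snd f})
      (inj₂ (Equivalence.from T-∨ (inj₁ (≡⇒== (trans (sym p) q)))))))
    share (inj₂ p) (inj₂ q) = Equivalence.from (T-∨ {fst e == fst f}) (inj₂ (Equivalence.from (T-∨ {fst e == snd f})
      (inj₂ (Equivalence.from (T-∨ {snd e == fst f}) (inj₂ (≡⇒== (trans (sym p) q)))))))

  L-adj⁻ : ∀ {e f} → Adj (L G) e f → e ≢ f × ∃[ v ] Inc v e × Inc v f
  L-adj⁻ {e} {f} a with Equivalence.to T-∧ (Equivalence.from T-≡ a)
  ... | ne , sh = (λ eq → T-not⁻ ne (≡⇒== eq)) , shared sh
    where
    shared : T (shareEnd (lookup (edges G) e) (lookup (edges G) f)) → ∃[ v ] Inc v e × Inc v f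
    shared s with Equivalence.to (T-∨ {fst e == fst f}) s
    ... | inj₁ p = _ , inj₁ refl , inj₁ (==⇒≡ p)
    ... | inj₂ s with Equivalence.to (T-∨ {fst e == snd f}) s
    ... | inj₁ p = _ , inj₁ refl , inj₂ (==⇒≡ p)
    ... | inj₂ s with Equivalence.to (T-∨ {snd e == fst f}) s
    ... | inj₁ p = _ , inj₂ refl , inj₁ (==⇒≡ p)
    ... | inj₂ p = _ , inj₂ refl , inj₂ (==⇒≡ p)

  L-simple : IsSimple (L G)
  L-simple = symmetric , irreflexive
    where
    L-sym : ∀ {e f} → Adj (L G) e f → Adj (L G) f e
    L-sym a with L-adj⁻ a
    ... | e≢f , v , i , j = L-adj⁺ (e≢f ∘ sym) j i

    symmetric : ∀ e f → adj (L G) e f ≡ adj (L G) f e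
    symmetric e f with adj (L G) e f in p | adj (L G) f e in q
    ... | true  | true  = refl
    ... | false | false = refl
    ... | true  | false = trans (sym (L-sym {e} {f} p)) q
    ... | false | true  = trans (sym p) (L-sym {f} {e} q)

    irreflexive : ∀ e → adj (L G) e e ≡ false
    irreflexive e with adj (L G) e e in p
    ... | false = refl
    ... | true  = contradiction refl (proj₁ (L-adj⁻ {e} {e} p))

  adj⇒joins : IsSimple G → ∀ {u v} → Adj G u v → ∃[ e ] Joins e u v
  adj⇒joins simple {u} {v} a with ℕ.<-cmp (toℕ u) (toℕ v)
  ... | tri< lt _ _ = index m , joins (inj₁ (cong proj₁ (lookup-index m))) (inj₂ (cong proj₂ (lookup-index m))) (adj-irrefl simple a)
    where m = ∈-edges⁺ lt a
  ... | tri≈ _ eq _ = contradiction (Fin.toℕ-injective eq) (adj-irrefl simple a)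
  ... | tri> _ _ gt = index m , joins (inj₂ (cong proj₂ (lookup-index m))) (inj₁ (cong proj₁ (lookup-index m))) (adj-irrefl simple a)
    where m = ∈-edges⁺ gt (adj-sym simple a)

  joins⇒adj : IsSimple G → ∀ {e u v} → Joins e u v → Adj G u v
  joins⇒adj simple {e} j with joins-ends′ j
  ... | inj₁ (refl , refl) = proj₂ (fst<snd×adj e)
  ... | inj₂ (refl , refl) = adj-sym simple (proj₂ (fst<snd×adj e))

line : ∀ {G} → IsSimple G → Line G (L G)
line {G} G-simple = record
  { simple       = G-simple
  ; L-simple     = LineOf.L-simple G
  ; fst          = LineOf.fst G
  ; snd          = LineOf.snd G
  ; joins-ends   = LineOf.joins-ends G
  ; joins-unique = LineOf.joins-unique G
  ; L-adj⁺       = LineOf.L-adj⁺ G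
  ; L-adj⁻       = LineOf.L-adj⁻ G
  ; adj⇒joins    = LineOf.adj⇒joins G G-simple
  ; joins⇒adj    = LineOf.joins⇒adj G G-simple
  }

-- Lower bounds on degrees.

-- Deg G k v: the degree of v is at least k.
record Deg (G : Graph) (k : ℕ) (v : V G) : Set where
  constructor deg
  field
    nbr           : Fin k → V G
    nbr-injective : Injective _≡_ _≡_ nbr
    nbr-adj       : ∀ i → Adj G v (nbr i)
open Deg

deg₀ : ∀ {G v} → Deg G 0 v
deg₀ = deg (λ ()) (λ { {()} }) (λ ())

deg-cons : ∀ {G k v x} → Adj G v x → (d : Deg G k v) → (∀ i → x ≢ nbr d i) → Deg G (suc k) v
deg-cons {G} {k} {v} {x} a d fresh = deg f f-inj f-adj
  where
  f : Fin (suc k) → V G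
  f zero    = x
  f (suc i) = nbr d i
  f-inj : Injective _≡_ _≡_ f
  f-inj {zero}  {zero}  _  = refl
  f-inj {zero}  {suc j} eq = contradiction eq (fresh j)
  f-inj {suc i} {zero}  eq = contradiction (sym eq) (fresh i)
  f-inj {suc i} {suc j} eq = cong suc (nbr-injective d eq)
  f-adj : ∀ i → Adj G v (f i)
  f-adj zero    = a
  f-adj (suc i) = nbr-adj d i

deg₁ : ∀ {G v a} → Adj G v a → Deg G 1 v
deg₁ va = deg-cons va deg₀ λ ()

deg₂ : ∀ {G v a b} → Adj G v a → Adj G v b → a ≢ b → Deg G 2 v
deg₂ va vb a≢b = deg-cons va (deg₁ vb) λ { zero → a≢b }

deg₃ : ∀ {G v a b c} → Adj G v a → Adj G v b → Adj G v c → a ≢ b → a ≢ c → b ≢ c → Deg G 3 v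
deg₃ va vb vc a≢b a≢c b≢c = deg-cons va (deg₂ vb vc b≢c) λ { zero → a≢b ; (suc zero) → a≢c }

deg-pred : ∀ {G k v} → Deg G (suc k) v → Deg G k v
deg-pred d = deg (nbr d ∘ suc) (Fin.suc-injective ∘ nbr-injective d) (nbr-adj d ∘ suc)

deg-avoid : ∀ {G k v} → Deg G (suc k) v → ∀ x → Σ (Deg G k v) λ d → ∀ i → nbr d i ≢ x
deg-avoid d x with Fin.any? (λ i → nbr d i ≟ x)
... | no none     = deg-pred d , λ i eq → none (suc i , eq)
... | yes (i , p) = deg (nbr d ∘ punchIn i) (Fin.punchIn-injective i _ _ ∘ nbr-injective d) (nbr-adj d ∘ punchIn i) ,
  λ j eq → Fin.punchInᵢ≢i i j (nbr-injective d (trans eq (sym p)))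

-- Distance to the vertices of degree at least 3.

data Near (G : Graph) : ℕ → V G → Set where
  here : ∀ {s v} → Deg G 3 v → Near G s v
  step : ∀ {s v w} → Adj G v w → Near G s w → Near G (suc s) v

near-mono : ∀ {G s t v} → s ≤ t → Near G s v → Near G t v
near-mono _         (here d)   = here d
near-mono (s≤s s≤t) (step a p) = step a (near-mono s≤t p)

near₀ : ∀ {G v} → Near G 0 v → Deg G 3 v
near₀ (here d) = d

-- No vertex of degree exactly 3 has only leaves as neighbours.
NoClaw : Graph → Set
NoClaw G = ∀ {u} → Deg G 3 u → Deg G 4 u ⊎ ∃[ x ] Adj G u x × Deg G 2 x

module _ {G H : Graph} (GH : Line G H) where
  open Line GH

  -- The other edges at `u` and the other edges at `v` are all neighbours of `e`. An edge in both
  -- families would contain `u` and `v`, which the avoided neighbours rule out.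
  joins-deg : ∀ {e u v j k} → Joins e u v → Deg G (suc j) u → Deg G (suc k) v → Deg H (j + k) e
  joins-deg {e} {u} {v} {j} {k} euv du dv with deg-avoid du v | deg-avoid dv u
  ... | du′ , ≢v | dv′ , ≢u = deg (λ i → f (splitAt j i)) inj (λ i → f-adj (splitAt j i))
    where
    left : ∀ i → ∃[ g ] Joins g u (nbr du′ i)
    left i = adj⇒joins (nbr-adj du′ i)
    right : ∀ i → ∃[ g ] Joins g v (nbr dv′ i)
    right i = adj⇒joins (nbr-adj dv′ i)
    f : Fin j ⊎ Fin k → V H
    f = [ proj₁ ∘ left , proj₁ ∘ right ]
    f-adj : ∀ i → Adj H e (f i)
    f-adj (inj₁ i) = fork-adj euv (proj₂ (left i)) (≢v i ∘ sym)
    f-adj (inj₂ i) = fork-adj (joins-sym euv) (proj₂ (right i)) (≢u i ∘ sym)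
    separate : ∀ i i′ → proj₁ (left i) ≢ proj₁ (right i′)
    separate i i′ eq with joins-only (proj₂ (right i′)) (subst (Inc u) eq (inc₁ (proj₂ (left i))))
    ... | inj₁ u≡v = distinct euv u≡v
    ... | inj₂ u≡x = ≢u i′ (sym u≡x)
    same : ∀ {g h x a b} → Joins g x a → Joins h x b → g ≡ h → a ≡ b
    same {a = a} {b} p q eq with a ≟ b
    ... | yes a≡b = a≡b
    ... | no a≢b  = contradiction eq (fork-distinct p q a≢b)
    f-inj : ∀ x y → f x ≡ f y → x ≡ y
    f-inj (inj₁ x) (inj₁ y) eq = cong inj₁ (nbr-injective du′ (same (proj₂ (left x)) (proj₂ (left y)) eq))
    f-inj (inj₁ x) (inj₂ y) eq = contradiction eq (separate x y)
    f-inj (inj₂ x) (inj₁ y) eq = contradiction (sym eq) (separate y x)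
    f-inj (inj₂ x) (inj₂ y) eq = cong inj₂ (nbr-injective dv′ (same (proj₂ (right x)) (proj₂ (right y)) eq))
    inj : Injective _≡_ _≡_ (λ i → f (splitAt j i))
    inj {x} {y} eq = trans (sym (Fin.join-splitAt j k x))
      (trans (cong (join j k) (f-inj (splitAt j x) (splitAt j y) eq)) (Fin.join-splitAt j k y))

  joins-deg₂ : ∀ {e u v} → Joins e u v → Deg G 3 u → Deg H 2 e
  joins-deg₂ euv du = joins-deg euv du (deg₁ (joins⇒adj (joins-sym euv)))

  module _ (noClaw : NoClaw G) where

    -- A fourth neighbour of `u` gives `e` itself degree 3. Otherwise some neighbour `x` of `u` has
    -- degree at least 2, and the edge from `u` to `x`, which is `e` or adjacent to it, has degree
    -- at least 2 + 1.
    near-joins₁ : ∀ {e u v} → Joins e u v → Deg G 3 u → Near H 1 e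
    near-joins₁ {e} {u} {v} euv du with noClaw du
    ... | inj₁ d = here (joins-deg euv d (deg₁ (joins⇒adj (joins-sym euv))))
    ... | inj₂ (x , ux , dx) with x ≟ v
    ...   | yes refl = here (joins-deg euv du dx)
    ...   | no x≢v with adj⇒joins ux
    ...     | f , fux = step (fork-adj euv fux (x≢v ∘ sym)) (here (joins-deg fux du dx))

    -- The edges of the walk, preceded by `e`, form a walk of the same length in `H`. Its last edge
    -- ends at a vertex of degree 3 and starts at one of degree at least 2, so its degree is at
    -- least 3; for an empty walk the start is `u`.
    near-joins : ∀ {s e u v} → Joins e u v → Deg G 2 u → Near G s v → Near H s e
    near-joins {e = e} euv du (here dv) = here (joins-deg (joins-sym euv) dv du)
    near-joins {e = e} {u} {v} euv du (step {s} {w = w} vw nw) with w ≟ u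
    near-joins {u = u} {v} euv du (step {s} vw nw) | no w≢u with adj⇒joins vw
    ... | f , fvw = step (fork-adj (joins-sym euv) fvw (w≢u ∘ sym))
                      (near-joins fvw (deg₂ vw (joins⇒adj (joins-sym euv)) w≢u) nw)
    -- `Near` admits walks that turn back to `u`; these are cut short.
    near-joins euv du (step vu (here du₃))         | yes refl = near-mono (s≤s z≤n) (near-joins₁ euv du₃)
    near-joins {v = v} euv du (step vu (step {w = w} uw nw)) | yes refl with w ≟ v
    ... | yes refl = near-mono (ℕ.m≤n+m _ 2) (near-joins euv du nw)
    ... | no w≢v with adj⇒joins uw
    ...   | f , fuw = near-mono (ℕ.n≤1+n _) (step (fork-adj euv fuw (w≢v ∘ sym)) (near-joins fuw du nw))

    -- Now the walk starts at `u` and nothing is known about the degree of `v`. If the walk does not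
    -- begin along `e`, then `u` lies on `e` and on the first edge of the walk, so it has degree 2
    -- and `near-joins` applies to that edge, one step away from `e`. The empty walk costs one step
    -- by `near-joins₁`, hence `1 ≤ t`.
    near-joins′ : ∀ {s t e u v} → Joins e u v → Near G s u → s ≤ t → 1 ≤ t → Near H t e
    near-joins′ euv (here du) _ 1≤t = near-mono 1≤t (near-joins₁ euv du)
    near-joins′ {v = v} euv (step {w = w} uw nw) s≤t 1≤t with w ≟ v
    ... | yes refl = near-joins′ (joins-sym euv) nw (ℕ.≤-trans (ℕ.n≤1+n _) s≤t) 1≤t
    ... | no w≢v with adj⇒joins uw
    ...   | f , fuw = near-mono s≤t (step (fork-adj euv fuw (w≢v ∘ sym))
              (near-joins fuw (deg₂ uw (joins⇒adj euv) w≢v) nw))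

  -- Every neighbour of `e` contains one of its two ends, so two of any three share an end and are
  -- adjacent. Each of these two has degree at least 2, the other neighbour being `e`.
  L-noClaw : NoClaw H
  L-noClaw {e} d = pigeon (side zero) (side (suc zero)) (side (suc (suc zero)))
    where
    side : ∀ i → Inc (fst e) (nbr d i) ⊎ Inc (snd e) (nbr d i)
    side i with L-adj⁻ (nbr-adj d i)
    ... | _ , v , inj₁ refl , q = inj₁ q
    ... | _ , v , inj₂ refl , q = inj₂ q
    meet : ∀ {v i j} → i ≢ j → Inc v (nbr d i) → Inc v (nbr d j) → Deg H 4 e ⊎ ∃[ x ] Adj H e x × Deg H 2 x
    meet {v} {i} {j} i≢j p q = inj₂ (nbr d i , nbr-adj d i ,
      deg₂ (adj-sym L-simple (nbr-adj d i)) (L-adj⁺ (i≢j ∘ nbr-injective d) p q)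
        (adj-irrefl L-simple (nbr-adj d j)))
    pigeon : ∀ {u v} → Inc u (nbr d zero) ⊎ Inc v (nbr d zero) →
      Inc u (nbr d (suc zero)) ⊎ Inc v (nbr d (suc zero)) →
      Inc u (nbr d (suc (suc zero))) ⊎ Inc v (nbr d (suc (suc zero))) →
      Deg H 4 e ⊎ ∃[ x ] Adj H e x × Deg H 2 x
    pigeon (inj₁ p) (inj₁ q) _        = meet (λ ()) p q
    pigeon (inj₂ p) (inj₂ q) _        = meet (λ ()) p q
    pigeon (inj₁ p) (inj₂ q) (inj₁ r) = meet (λ ()) p r
    pigeon (inj₁ p) (inj₂ q) (inj₂ r) = meet (λ ()) q r
    pigeon (inj₂ p) (inj₁ q) (inj₁ r) = meet (λ ()) q r
    pigeon (inj₂ p) (inj₁ q) (inj₂ r) = meet (λ ()) p r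

module _ {G H K : Graph} (GH : Line G H) (HK : Line H K) (noClaw : NoClaw G) where
  open Line GH

  near-LL-centre₃ : ∀ {c e f v u w r} → Line.Joins HK c e f → Joins e v u → Joins f v w → Deg G 3 v → Near K (suc r) c
  near-LL-centre₃ cef evu fvw dv = near-mono (s≤s z≤n)
    (near-joins HK (L-noClaw GH) cef (joins-deg₂ GH evu dv) (near-joins₁ GH noClaw fvw dv))

  -- The middle `v` of the path has degree at least 2. If the walk from `v` begins along one of the
  -- two edges of the path, `near-joins` absorbs that step. Otherwise it begins along a third edge
  -- and `v` itself has degree 3.
  near-LL : ∀ {r} → (∀ v → Near G (suc (suc r)) v) → ∀ c → Near K (suc r) c
  near-LL {r} near c = go (adj-fork (Line.joins⇒adj HK cef))
    where
    cef = Line.joins-ends HK c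
    go : ∃[ v ] ∃[ u ] ∃[ w ] Joins (Line.fst HK c) v u × Joins (Line.snd HK c) v w × u ≢ w → Near K (suc r) c
    go (v , u , w , evu , fvw , u≢w) with near v
    ... | here dv = near-LL-centre₃ cef evu fvw dv
    ... | step {w = x} vx nx with x ≟ u | x ≟ w
    ...   | yes refl | _ = near-joins′ HK (L-noClaw GH) cef
              (near-joins GH noClaw evu (deg₂ (joins⇒adj evu) (joins⇒adj fvw) u≢w) nx) ℕ.≤-refl (s≤s z≤n)
    ...   | no _ | yes refl = near-joins′ HK (L-noClaw GH) (Line.joins-sym HK cef)
              (near-joins GH noClaw fvw (deg₂ (joins⇒adj evu) (joins⇒adj fvw) u≢w) nx) ℕ.≤-refl (s≤s z≤n)
    ...   | no x≢u | no x≢w = near-LL-centre₃ cef evu fvw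
              (deg₃ vx (joins⇒adj evu) (joins⇒adj fvw) x≢u x≢w u≢w)

module _ {G H : Graph} (GH : Line G H) where
  open Line GH

  near₁-L-deg₂ : (∀ v → Near G 1 v) → ∀ e → Deg H 2 e
  near₁-L-deg₂ near e with near (fst e) | near (snd e)
  ... | here du  | _       = joins-deg₂ GH (joins-ends e) du
  ... | step _ _ | here dv = joins-deg₂ GH (joins-sym (joins-ends e)) dv
  ... | step {w = x} ux nx | step {w = y} vy ny with x ≟ snd e | y ≟ fst e
  ...   | yes refl | _        = joins-deg₂ GH (joins-sym (joins-ends e)) (near₀ nx)
  ...   | no _     | yes refl = joins-deg₂ GH (joins-ends e) (near₀ ny)
  ...   | no x≢v   | no y≢u   = joins-deg GH (joins-ends e)
            (deg₂ ux (joins⇒adj (joins-ends e)) x≢v)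
            (deg₂ vy (joins⇒adj (joins-sym (joins-ends e))) y≢u)

  L-deg₄ : (∀ v → Deg G 3 v) → ∀ e → Deg H 4 e
  L-deg₄ d e = joins-deg GH (joins-ends e) (d _) (d _)

module _ {G H K : Graph} (GH : Line G H) (HK : Line H K) where
  open Line GH

  -- One edge of the path touches a vertex of degree at least 3, so its degree in `H` is at least 2
  -- + 1; the other has degree at least 1 + 1. Joining them yields 2 + 1 again.
  near₁-LL-deg₃ : (∀ v → Near G 1 v) → (∀ v → Deg G 2 v) → ∀ c → Deg K 3 c
  near₁-LL-deg₃ near d₂ c = go (adj-fork (Line.joins⇒adj HK cef))
    where
    cef = Line.joins-ends HK c
    go : ∃[ v ] ∃[ u ] ∃[ w ] Joins (Line.fst HK c) v u × Joins (Line.snd HK c) v w × u ≢ w → Deg K 3 c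
    go (v , u , w , evu , fvw , u≢w) = by-centre (near v)
      where
      by-centre : Near G 1 v → Deg K 3 c
      by-centre (here dv) = joins-deg HK cef (joins-deg GH evu dv (d₂ u)) (joins-deg GH fvw (d₂ v) (d₂ w))
      by-centre (step {w = x} vx nx) with x ≟ u | x ≟ w
      ... | yes refl | _ = joins-deg HK cef (joins-deg GH (joins-sym evu) (near₀ nx) (d₂ v)) (joins-deg GH fvw (d₂ v) (d₂ w))
      ... | no _ | yes refl = joins-deg HK (Line.joins-sym HK cef)
              (joins-deg GH (joins-sym fvw) (near₀ nx) (d₂ v)) (joins-deg GH evu (d₂ v) (d₂ u))
      ... | no x≢u | no x≢w = by-centre (here (deg₃ vx (joins⇒adj evu) (joins⇒adj fvw) x≢u x≢w u≢w))

infixr 5 _∷_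

-- Steps are listed from the base upwards, against the recursion of `L^`, because the arguments on
-- distances and fibres consume the base first.
data Iterate : ℕ → Graph → Graph → Set where
  []  : ∀ {G} → Iterate 0 G G
  _∷_ : ∀ {k G H K} → Line G H → Iterate k H K → Iterate (suc k) G K

Deg₄Graph : Graph → Set
Deg₄Graph G = ∀ v → Deg G 4 v

-- Two line graphs lower the radius by one. At radius 1 four more suffice: one for minimum degree 2
-- with the radius kept, two for degree 3, and one for degree 3 + 3 - 2 = 4.
near⇒deg₄ : ∀ r {G} → NoClaw G → (∀ v → Near G (suc r) v) → ∀ {H} → Iterate (r * 2 + 4) G H → Deg₄Graph H
near⇒deg₄ zero    noClaw near (l₁ ∷ l₂ ∷ l₃ ∷ l₄ ∷ []) = L-deg₄ l₄ (near₁-LL-deg₃ l₂ l₃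
  (λ e → near-joins′ l₁ noClaw (Line.joins-ends l₁ e) (near _) ℕ.≤-refl ℕ.≤-refl)
  (near₁-L-deg₂ l₁ near))
near⇒deg₄ (suc r) noClaw near (l₁ ∷ l₂ ∷ ls) = near⇒deg₄ r (L-noClaw l₂) (near-LL l₁ l₂ noClaw near) ls

-- Automorphisms of a graph and of its line graph.

record Aut (G : Graph) : Set where
  field
    to from  : V G → V G
    to-from  : ∀ v → to (from v) ≡ v
    from-to  : ∀ v → from (to v) ≡ v
    to-adj   : ∀ {u v} → Adj G u v → Adj G (to u) (to v)
    from-adj : ∀ {u v} → Adj G u v → Adj G (from u) (from v)

  to-injective : Injective _≡_ _≡_ to
  to-injective {x} {y} eq = trans (sym (from-to x)) (trans (cong from eq) (from-to y))

  inverse : Aut G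
  inverse = record
    { to = from ; from = to ; to-from = from-to ; from-to = to-from ; to-adj = from-adj ; from-adj = to-adj }
open Aut using (to; from; to-adj; to-injective; inverse)

isAut⇒Aut : ∀ {G} (π : Permutation′ (n G)) → IsAut G π → Aut G
isAut⇒Aut {G} π aut = record
  { to       = π ⟨$⟩ʳ_
  ; from     = π ⟨$⟩ˡ_
  ; to-from  = λ _ → inverseʳ π
  ; from-to  = λ _ → inverseˡ π
  ; to-adj   = trans (aut _ _)
  ; from-adj = λ {u} {v} a → trans (sym (aut _ _)) (subst₂ (Adj G) (sym (inverseʳ π)) (sym (inverseʳ π)) a)
  }

distinguishes : ∀ {G k} (f : V G → Fin k) →
  (∀ (π : Aut G) → (∀ v → f (to π v) ≡ f v) → ∀ v → to π v ≡ v) → Distinguishes G f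
distinguishes f rigid π aut (v , πv≢v) with Fin.any? (λ x → ¬? (f x ≟ f (π ⟨$⟩ʳ x)))
... | yes found = found
... | no none   = contradiction (rigid (isAut⇒Aut π aut) fixed v) πv≢v
  where
  fixed : ∀ x → f (π ⟨$⟩ʳ x) ≡ f x
  fixed x with f x ≟ f (π ⟨$⟩ʳ x)
  ... | yes eq = sym eq
  ... | no neq = contradiction (x , neq) none

module _ {G H : Graph} (GH : Line G H) where
  open Line GH

  -- If w ∉ r, then r completes p and q to a triangle, and no fourth edge meets all three sides
  -- of a triangle.
  four-edges-star : ∀ {p q r s w} → Adj H p q → Adj H p r → Adj H q r →
    Adj H p s → Adj H q s → Adj H r s → Inc w p → Inc w q → Inc w r
  four-edges-star {p} {q} {r} {s} {w} pq pr qr ps qs rs wp wq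
    with inc⇒joins wp | inc⇒joins wq
  ... | a , pwa | b , qwb = by-cases (meets pwa pr) (meets qwb qr)
    where
    meets : ∀ {e f u v} → Joins e u v → Adj H e f → Inc u f ⊎ Inc v f
    meets j ef with L-adj⁻ ef
    ... | _ , x , xe , xf with joins-only j xe
    ...   | inj₁ refl = inj₁ xf
    ...   | inj₂ refl = inj₂ xf
    a≢b : a ≢ b
    a≢b refl = proj₁ (L-adj⁻ pq) (joins-unique pwa qwb)
    -- Here `r` joins `a` and `b`. Meeting all three sides, `s` contains two of the corners `w`,
    -- `a`, `b` and coincides with a side.
    no-fourth : Inc a r → Inc b r → ⊥
    no-fourth ar br with meets pwa ps | meets qwb qs
    ... | inj₂ as | inj₂ bs = proj₁ (L-adj⁻ rs) (joins-unique (joins ar br a≢b) (joins as bs a≢b))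
    ... | inj₁ ws | _ with meets (joins ar br a≢b) rs
    ...   | inj₁ as = proj₁ (L-adj⁻ ps) (joins-unique pwa (joins ws as (distinct pwa)))
    ...   | inj₂ bs = proj₁ (L-adj⁻ qs) (joins-unique qwb (joins ws bs (distinct qwb)))
    no-fourth ar br | inj₂ as | inj₁ ws =
      proj₁ (L-adj⁻ ps) (joins-unique pwa (joins ws as (distinct pwa)))
    by-cases : Inc w r ⊎ Inc a r → Inc w r ⊎ Inc b r → Inc w r
    by-cases (inj₁ wr) _         = wr
    by-cases (inj₂ _)  (inj₁ wr) = wr
    by-cases (inj₂ ar) (inj₂ br) = ⊥-elim (no-fourth ar br)

  module _ (d : ∀ v → Deg G 4 v) where

    edgeAt : ∀ v (i : Fin 4) → ∃[ e ] Joins e v (nbr (d v) i)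
    edgeAt v i = adj⇒joins (nbr-adj (d v) i)

    edgeAt-adj : ∀ v {i j} → i ≢ j → Adj H (proj₁ (edgeAt v i)) (proj₁ (edgeAt v j))
    edgeAt-adj v i≢j = fork-adj (proj₂ (edgeAt v _)) (proj₂ (edgeAt v _)) (i≢j ∘ nbr-injective (d v))

    module _ (π : Aut H) where

      private
        image-edges : ∀ v → ∃[ w ] Inc w (to π (proj₁ (edgeAt v zero))) × Inc w (to π (proj₁ (edgeAt v (suc zero))))
        image-edges v = proj₂ (L-adj⁻ (to-adj π (edgeAt-adj v λ ())))

      image : V G → V G
      image v = proj₁ (image-edges v)

      -- The two edges that define `image v`, the edge `e` and a further edge at `v` are pairwise
      -- adjacent, hence so are their images, and `four-edges-star` applies. One of the two
      -- remaining chosen edges differs from `e`; this is where degree 4 enters.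
      image-inc : ∀ {v e} → Inc v e → Inc (image v) (to π e)
      image-inc {v} {e} ve with e ≟ proj₁ (edgeAt v zero) | e ≟ proj₁ (edgeAt v (suc zero))
      ... | yes refl | _        = proj₁ (proj₂ (image-edges v))
      ... | no _     | yes refl = proj₂ (proj₂ (image-edges v))
      ... | no e≢0   | no e≢1   = four-edges-star
        (to-adj π (edgeAt-adj v λ ())) (to-adj π (meet e≢0)) (to-adj π (meet e≢1))
        (to-adj π (edgeAt-adj v (proj₁ (proj₂ other)))) (to-adj π (edgeAt-adj v (proj₁ (proj₂ (proj₂ other)))))
        (to-adj π (proj₂ (proj₂ (proj₂ other))))
        (proj₁ (proj₂ (image-edges v))) (proj₂ (proj₂ (image-edges v)))
        where
        meet : ∀ {i} → e ≢ proj₁ (edgeAt v i) → Adj H (proj₁ (edgeAt v i)) e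
        meet neq = L-adj⁺ (neq ∘ sym) (inc₁ (proj₂ (edgeAt v _))) ve
        other : ∃[ i ] zero ≢ i × suc zero ≢ i × Adj H e (proj₁ (edgeAt v i))
        other with e ≟ proj₁ (edgeAt v (suc (suc zero)))
        ... | no e≢2   = suc (suc zero) , (λ ()) , (λ ()) , adj-sym L-simple (meet e≢2)
        ... | yes refl = suc (suc (suc zero)) , (λ ()) , (λ ()) , edgeAt-adj v λ ()

    -- Both vertices lie on the same two distinct edges, which have at most one vertex in common.
    image-inverse : ∀ π v → image (inverse π) (image π v) ≡ v
    image-inverse π v = common-unique (proj₁ (L-adj⁻ (edgeAt-adj v {zero} {suc zero} λ ())))
      (back zero) (back (suc zero)) (inc₁ (proj₂ (edgeAt v zero))) (inc₁ (proj₂ (edgeAt v (suc zero))))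
      where
      back : ∀ i → Inc (image (inverse π) (image π v)) (proj₁ (edgeAt v i))
      back i = subst (Inc _) (Aut.from-to π _) (image-inc (inverse π) (image-inc π (inc₁ (proj₂ (edgeAt v i)))))

    image-injective : ∀ π → Injective _≡_ _≡_ (image π)
    image-injective π {x} {y} eq = trans (sym (image-inverse π x)) (trans (cong (image (inverse π)) eq) (image-inverse π y))

    image-joins : ∀ π {e u v} → Joins e u v → Joins (to π e) (image π u) (image π v)
    image-joins π j = joins (image-inc π (inc₁ j)) (image-inc π (inc₂ j)) (distinct j ∘ image-injective π)

    image-adj : ∀ π {u v} → Adj G u v → Adj G (image π u) (image π v)
    image-adj π uv = joins⇒adj (image-joins π (proj₂ (adj⇒joins uv)))

    -- Whitney's theorem in minimum degree at least 4.
    induced : Aut H → Aut G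
    induced π = record
      { to       = image π
      ; from     = image (inverse π)
      ; to-from  = image-inverse (inverse π)
      ; from-to  = image-inverse π
      ; to-adj   = image-adj π
      ; from-adj = image-adj (inverse π)
      }

    induced-trivial : ∀ π → (∀ v → image π v ≡ v) → ∀ e → to π e ≡ e
    induced-trivial π fixed e = joins-unique
      (subst₂ (Joins (to π e)) (fixed _) (fixed _) (image-joins π (joins-ends e))) (joins-ends e)

-- Fibrations of iterated line graphs over a base.

-- X stands for an iterated line graph of H, and own is equivariant.
record Fibration (m : ℕ) (X H : Graph) : Set where
  field
    own           : V X → V H
    fib           : V H → Fin m → V X
    own-fib       : ∀ v i → own (fib v i) ≡ v
    fib-injective : ∀ v → Injective _≡_ _≡_ (fib v)
    descend       : Aut X → Aut H
    own-descend   : ∀ π x → own (to π x) ≡ to (descend π) (own x)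
    descend-trivial : ∀ π → (∀ v → to (descend π) v ≡ v) → ∀ x → to π x ≡ x

id-fibration : ∀ {H} → Fibration 1 H H
id-fibration = record
  { own = id ; fib = λ v _ → v ; own-fib = λ _ _ → refl ; fib-injective = λ { v {zero} {zero} _ → refl }
  ; descend = id ; own-descend = λ _ _ → refl ; descend-trivial = λ _ fixed → fixed }

module _ {G H K : Graph} (GH : Line G H) (HK : Line H K)
         (dG : ∀ v → Deg G 4 v) (dH : ∀ v → Deg H 4 v) where
  open Line GH

  private
    centre-spec : ∀ c → ∃[ v ] Inc v (Line.fst HK c) × Inc v (Line.snd HK c)
    centre-spec c = proj₂ (L-adj⁻ (Line.joins⇒adj HK (Line.joins-ends HK c)))

  -- A vertex of the second line graph of G is a path of G with two edges.
  centre : V K → V G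
  centre c = proj₁ (centre-spec c)

  centre-unique : ∀ {c e f v} → Line.Joins HK c e f → Inc v e → Inc v f → centre c ≡ v
  centre-unique {c} cef ve vf with Line.joins-only HK cef (inj₁ refl) | Line.joins-only HK cef (inj₂ refl) | centre-spec c
  ... | inj₁ refl | inj₁ p    | _            = contradiction (sym p) (distinct (Line.joins-ends HK c))
  ... | inj₂ refl | inj₂ p    | _            = contradiction (sym p) (distinct (Line.joins-ends HK c))
  ... | inj₁ refl | inj₂ refl | (_ , i , j)  = common-unique (distinct cef) i j ve vf
  ... | inj₂ refl | inj₁ refl | (_ , i , j)  = common-unique (distinct cef) j i ve vf

  cherry : ∀ v (i : Fin 3) → ∃[ c ] Line.Joins HK c (proj₁ (edgeAt GH dG v zero)) (proj₁ (edgeAt GH dG v (suc i)))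
  cherry v i = Line.adj⇒joins HK (edgeAt-adj GH dG v λ ())

  centre-cherry : ∀ v i → centre (proj₁ (cherry v i)) ≡ v
  centre-cherry v i = centre-unique (proj₂ (cherry v i))
    (inc₁ (proj₂ (edgeAt GH dG v zero))) (inc₁ (proj₂ (edgeAt GH dG v (suc i))))

  cherry-distinct : ∀ v → proj₁ (cherry v zero) ≢ proj₁ (cherry v (suc zero))
  cherry-distinct v = Line.fork-distinct HK (proj₂ (cherry v zero)) (proj₂ (cherry v (suc zero)))
    (proj₁ (L-adj⁻ (edgeAt-adj GH dG v λ ())))

  -- Here `X` is the base and `G` the old total graph. Each old point of a fibre contributes a path
  -- centred at it, and the first contributes a second one, so the fibre grows by one. Paths from
  -- different points differ because their centres do.
  LL-fibration : ∀ {m X} → Fibration (suc m) G X → Fibration (suc (suc m)) K X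
  LL-fibration {m} {X} F = record
    { own             = own ∘ centre
    ; fib             = fib′
    ; own-fib         = own-fib′
    ; fib-injective   = fib′-injective
    ; descend         = descend ∘ induced GH dG ∘ induced HK dH
    ; own-descend     = λ π c → trans (cong own (centre-image π c))
        (own-descend (induced GH dG (induced HK dH π)) (centre c))
    ; descend-trivial = λ π fixed → induced-trivial HK dH π
        (induced-trivial GH dG (induced HK dH π) (descend-trivial (induced GH dG (induced HK dH π)) fixed))
    }
    where
    open Fibration F
    fib′ : V X → Fin (suc (suc m)) → V K
    fib′ x zero    = proj₁ (cherry (fib x zero) zero)
    fib′ x (suc i) = proj₁ (cherry (fib x i) (suc zero))
    own-fib′ : ∀ x i → own (centre (fib′ x i)) ≡ x
    own-fib′ x zero    = trans (cong own (centre-cherry _ _)) (own-fib x zero)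
    own-fib′ x (suc i) = trans (cong own (centre-cherry _ _)) (own-fib x i)
    same-centre : ∀ {u v i j} → proj₁ (cherry u i) ≡ proj₁ (cherry v j) → u ≡ v
    same-centre {u} {v} {i} {j} eq = trans (sym (centre-cherry u i)) (trans (cong centre eq) (centre-cherry v j))
    clash : ∀ x i → fib′ x zero ≢ fib′ x (suc i)
    clash x i eq with fib-injective x (same-centre eq)
    ... | refl = cherry-distinct _ eq
    fib′-injective : ∀ x → Injective _≡_ _≡_ (fib′ x)
    fib′-injective x {zero}  {zero}  _  = refl
    fib′-injective x {zero}  {suc j} eq = contradiction eq (clash x j)
    fib′-injective x {suc i} {zero}  eq = contradiction (sym eq) (clash x i)
    fib′-injective x {suc i} {suc j} eq = cong suc (fib-injective x (same-centre eq))
    centre-image : ∀ π c → centre (to π c) ≡ image GH dG (induced HK dH π) (centre c)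
    centre-image π c = centre-unique (image-joins HK dH π (Line.joins-ends HK c))
      (image-inc GH dG (induced HK dH π) (proj₁ (proj₂ (centre-spec c))))
      (image-inc GH dG (induced HK dH π) (proj₂ (proj₂ (centre-spec c))))

-- The two-colouring of a fibration with large fibres.

module _ {m X H} (F : Fibration m X H) (n≤m : n H ≤ m) where
  open Fibration F

  -- The fibre over v contains exactly toℕ v red points.
  Red : V X → Set
  Red x = ∃[ i ] toℕ i < toℕ (own x) × fib (own x) i ≡ x

  red? : ∀ x → Dec (Red x)
  red? x = Fin.any? λ i → (i <? own x) ×-dec (fib (own x) i ≟ x)

  colour : V X → Fin 2
  colour x with red? x
  ... | yes _ = suc zero
  ... | no _  = zero

  colour-red : ∀ {x y} → colour y ≡ colour x → Red x → Red y
  colour-red {x} {y} eq r with red? x | red? y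
  ... | _      | yes r′ = r′
  ... | no ¬r  | _      = contradiction r ¬r
  colour-red {x} {y} () r | yes _ | no _

  module _ (π : Aut X) (pres : ∀ x → colour (to π x) ≡ colour x) where

    -- The `toℕ v` red points over `v` are carried injectively to red points over the image of `v`,
    -- whose number is the index of that image.
    descend-≤ : ∀ v → toℕ v ≤ toℕ (to (descend π) v)
    descend-≤ v = Fin.injective⇒≤ {f = g} g-injective
      where
      v≤m : toℕ v ≤ m
      v≤m = ℕ.≤-trans (ℕ.<⇒≤ (Fin.toℕ<n v)) n≤m
      point : Fin (toℕ v) → V X
      point i = fib v (inject≤ i v≤m)
      point-red : ∀ i → Red (point i)
      point-red i = subst (λ w → ∃[ j ] toℕ j < toℕ w × fib w j ≡ point i) (sym (own-fib v _))
        (inject≤ i v≤m , subst (_< toℕ v) (sym (Fin.toℕ-inject≤ i v≤m)) (Fin.toℕ<n i) , refl)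
      own-image : ∀ i → own (to π (point i)) ≡ to (descend π) v
      own-image i = trans (own-descend π _) (cong (to (descend π)) (own-fib v _))
      image-red : ∀ i → ∃[ j ] toℕ j < toℕ (to (descend π) v) × fib (to (descend π) v) j ≡ to π (point i)
      image-red i = subst (λ w → ∃[ j ] toℕ j < toℕ w × fib w j ≡ to π (point i)) (own-image i)
        (colour-red (pres (point i)) (point-red i))
      g : Fin (toℕ v) → Fin (toℕ (to (descend π) v))
      g i = fromℕ< (proj₁ (proj₂ (image-red i)))
      g-injective : Injective _≡_ _≡_ g
      g-injective {i} {j} eq = Fin.inject≤-injective v≤m v≤m i j (fib-injective v (to-injective π
        (trans (sym (proj₂ (proj₂ (image-red i))))
          (trans (cong (fib _) (Fin.toℕ-injective (Fin.fromℕ<-injective _ _ _ _ eq)))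
            (proj₂ (proj₂ (image-red j)))))))

  fibration-D≤2 : D≤ X 2
  fibration-D≤2 = colour , distinguishes colour rigid
    where
    rigid : ∀ π → (∀ x → colour (to π x) ≡ colour x) → ∀ x → to π x ≡ x
    rigid π pres = descend-trivial π λ v → Fin.toℕ-injective (ℕ.≤-antisym
      (subst (toℕ (to (descend π) v) ≤_) (cong toℕ (cancel v)) (descend-≤ (inverse π) pres⁻ _))
      (descend-≤ π pres v))
      where
      pres⁻ : ∀ x → colour (from π x) ≡ colour x
      pres⁻ x = trans (sym (pres (from π x))) (cong colour (Aut.to-from π x))
      -- `descend` carries no composition law, so the cancellation is read off at a point of the
      -- fibre over `v`. The index of that point is `v` itself, which fits since `n H ≤ m`.
      cancel : ∀ v → to (descend (inverse π)) (to (descend π) v) ≡ v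
      cancel v = trans (cong (to (descend (inverse π))) (sym (trans (own-descend π x) (cong (to (descend π)) (own-fib v i)))))
        (trans (sym (own-descend (inverse π) (to π x))) (trans (cong own (Aut.from-to π x)) (own-fib v i)))
        where
        i = inject≤ v n≤m
        x = fib v i

-- Paths and cycles and their line graphs.

adj? : ∀ G u v → Dec (Adj G u v)
adj? G u v = adj G u v Bool.≟ true

⇔⇒≡ : ∀ {x y} → (x ≡ true → y ≡ true) → (y ≡ true → x ≡ true) → x ≡ y
⇔⇒≡ {true}          f g = sym (f refl)
⇔⇒≡ {false} {true}  f g = g refl
⇔⇒≡ {false} {false} f g = refl

Surjection : ∀ {A B : Set} → (A → B) → Set
Surjection {A} f = ∀ y → ∃[ x ] f x ≡ y

isomorphic : ∀ {G H} (w : V H → V G) → Injective _≡_ _≡_ w → Surjection w →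
  (∀ i j → adj G (w i) (w j) ≡ adj H i j) → Isomorphic G H
isomorphic {G} {H} w w-inj w-surj same =
  permutation (proj₁ ∘ w-surj) w (λ i → w-inj (proj₂ (w-surj (w i)))) (λ v → proj₂ (w-surj v)) ,
  λ u v → trans (sym (same _ _)) (cong₂ (adj G) (proj₂ (w-surj u)) (proj₂ (w-surj v)))

Consec : ∀ {m} → Fin m → Fin m → Set
Consec i j = suc (toℕ i) ≡ toℕ j

-- `m` counts vertices, so each line graph lowers it by one, and `Path 0` describes the empty graph.
record Path (m : ℕ) (G : Graph) : Set where
  field
    word            : Fin m → V G
    word-injective  : Injective _≡_ _≡_ word
    word-surjective : Surjection word
    word-adj⁺       : ∀ {i j} → Consec i j → Adj G (word i) (word j)
    word-adj⁻       : ∀ {i j} → Adj G (word i) (word j) → Consec i j ⊎ Consec j i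

module _ {m G H} (P : Path (suc m) G) (GH : Line G H) where
  open Path P
  open Line GH

  private
    linkEdge : ∀ i → ∃[ e ] Joins e (word (inject₁ i)) (word (suc i))
    linkEdge i = adj⇒joins (word-adj⁺ (cong suc (Fin.toℕ-inject₁ i)))

    link : Fin m → V H
    link = proj₁ ∘ linkEdge

    link-joins : ∀ i → Joins (link i) (word (inject₁ i)) (word (suc i))
    link-joins = proj₂ ∘ linkEdge

    meeting : ∀ {x} i j → Inc x (link i) → Inc x (link j) → i ≡ j ⊎ Consec i j ⊎ Consec j i
    meeting i j p q with joins-only (link-joins i) p | joins-only (link-joins j) q
    ... | inj₁ a | inj₁ b = inj₁ (Fin.inject₁-injective (word-injective (trans (sym a) b)))
    ... | inj₁ a | inj₂ b = inj₂ (inj₂ (trans (cong toℕ (word-injective (trans (sym b) a))) (Fin.toℕ-inject₁ i)))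
    ... | inj₂ a | inj₁ b = inj₂ (inj₁ (trans (cong toℕ (word-injective (trans (sym a) b))) (Fin.toℕ-inject₁ j)))
    ... | inj₂ a | inj₂ b = inj₁ (Fin.suc-injective (word-injective (trans (sym a) b)))

    link-injective : Injective _≡_ _≡_ link
    link-injective {i} {j} eq
      with joins-only (link-joins j) (subst (Inc _) eq (inc₁ (link-joins i)))
         | joins-only (link-joins j) (subst (Inc _) eq (inc₂ (link-joins i)))
    ... | inj₁ a | _      = Fin.inject₁-injective (word-injective a)
    ... | inj₂ _ | inj₂ b = Fin.suc-injective (word-injective b)
    ... | inj₂ a | inj₁ b = ⊥-elim (ℕ.<-asym
      (ℕ.≤-reflexive (trans (cong toℕ (word-injective b)) (Fin.toℕ-inject₁ j)))
      (ℕ.≤-reflexive (trans (sym (cong toℕ (word-injective a))) (Fin.toℕ-inject₁ i))))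

    consec-link : ∀ {i j} → Consec i j → ∃[ k ] Joins (link k) (word i) (word j)
    consec-link {i} {suc k} eq = k , subst (λ x → Joins (link k) (word x) (word (suc k)))
      (Fin.toℕ-injective (trans (Fin.toℕ-inject₁ k) (sym (ℕ.suc-injective eq)))) (link-joins k)

    link-surjective : Surjection link
    link-surjective e with word-surjective (fst e) | word-surjective (snd e)
    ... | i , p | j , q with subst₂ (Joins e) (sym p) (sym q) (joins-ends e)
    ... | eij with word-adj⁻ (joins⇒adj eij)
    ...   | inj₁ ij = proj₁ (consec-link ij) , joins-unique (proj₂ (consec-link ij)) eij
    ...   | inj₂ ji = proj₁ (consec-link ji) , joins-unique (joins-sym (proj₂ (consec-link ji))) eij

  L-path : Path m H
  L-path = record
    { word            = link
    ; word-injective  = link-injective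
    ; word-surjective = link-surjective
    ; word-adj⁺       = λ {i} {j} ij → L-adj⁺
        (λ eq → ℕ.<-irrefl (trans (cong toℕ (link-injective eq)) (sym ij)) ℕ.≤-refl)
        (inc₂ (link-joins i))
        (subst (λ x → Inc (word x) (link j)) (Fin.toℕ-injective (trans (Fin.toℕ-inject₁ j) (sym ij))) (inc₁ (link-joins j)))
    ; word-adj⁻       = adj⁻
    }
    where
    adj⁻ : ∀ {i j} → Adj H (link i) (link j) → Consec i j ⊎ Consec j i
    adj⁻ {i} {j} a with L-adj⁻ a
    ... | i≢j , x , p , q with meeting i j p q
    ...   | inj₁ refl = contradiction refl i≢j
    ...   | inj₂ c    = c

iterate-empty : ∀ {k G H} → Iterate k G H → ¬ V G → ¬ V H
iterate-empty []         empty = empty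
iterate-empty (GH ∷ ls) empty = iterate-empty ls (empty ∘ Line.fst GH)

iterate-path : ∀ {m k G H} → Path m G → m ≤ k → Iterate k G H → ¬ V H
iterate-path P z≤n ls = iterate-empty ls λ v → Fin.¬Fin0 (proj₁ (Path.word-surjective P v))
iterate-path P (s≤s m≤k) (GH ∷ ls) = iterate-path (L-path P GH) m≤k ls

Next : ∀ {N} → Fin N → Fin N → Set
Next {N} i j = Consec i j ⊎ (suc (toℕ i) ≡ N × toℕ j ≡ 0)

next? : ∀ {N} (i j : Fin N) → Dec (Next i j)
next? {N} i j = (suc (toℕ i) ℕ.≟ toℕ j) ⊎-dec ((suc (toℕ i) ℕ.≟ N) ×-dec (toℕ j ℕ.≟ 0))

next : ∀ {N} (i : Fin N) → ∃[ j ] Next i j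
next {suc N} i with suc (toℕ i) ℕ.≟ suc N
... | yes eq = zero , inj₂ (eq , refl)
... | no neq = fromℕ< lt , inj₁ (sym (Fin.toℕ-fromℕ< lt))
  where lt = ℕ.≤∧≢⇒< (Fin.toℕ<n i) neq

next-functional : ∀ {N} {i j k : Fin N} → Next i j → Next i k → j ≡ k
next-functional (inj₁ p) (inj₁ q) = Fin.toℕ-injective (trans (sym p) q)
next-functional {j = j} (inj₁ p) (inj₂ (q , _)) = contradiction (trans (sym p) q) (ℕ.<⇒≢ (Fin.toℕ<n j))
next-functional {k = k} (inj₂ (p , _)) (inj₁ q) = contradiction (trans (sym q) p) (ℕ.<⇒≢ (Fin.toℕ<n k))
next-functional (inj₂ (_ , p)) (inj₂ (_ , q)) = Fin.toℕ-injective (trans p (sym q))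

next-injective : ∀ {N} {i j k : Fin N} → Next i k → Next j k → i ≡ j
next-injective (inj₁ p) (inj₁ q) = Fin.toℕ-injective (ℕ.suc-injective (trans p (sym q)))
next-injective (inj₁ p) (inj₂ (_ , q)) = contradiction (trans p q) λ ()
next-injective (inj₂ (_ , p)) (inj₁ q) = contradiction (trans q p) λ ()
next-injective (inj₂ (p , _)) (inj₂ (q , _)) = Fin.toℕ-injective (ℕ.suc-injective (trans p (sym q)))

-- Two steps forward return to the start only in a cycle of length at most 2, whence `3 + N`.
next-asym : ∀ {N} {i j : Fin (3 + N)} → Next i j → ¬ Next j i
next-asym (inj₁ p) (inj₁ q) = ℕ.<-asym (ℕ.≤-reflexive p) (ℕ.≤-reflexive q)
next-asym (inj₁ p) (inj₂ (q , r)) with trans (cong suc (trans (cong suc (sym r)) p)) q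
... | ()
next-asym (inj₂ (p , r)) (inj₁ q) with trans (cong suc (trans (cong suc (sym r)) q)) p
... | ()
next-asym (inj₂ (p , _)) (inj₂ (_ , r)) with trans (sym p) (cong suc r)
... | ()

Cyclic : ∀ {N} → Fin N → Fin N → Set
Cyclic i j = Next i j ⊎ Next j i

record Cycle (N : ℕ) (G : Graph) : Set where
  field
    word            : Fin N → V G
    word-injective  : Injective _≡_ _≡_ word
    word-surjective : Surjection word
    word-adj⁺       : ∀ {i j} → Cyclic i j → Adj G (word i) (word j)
    word-adj⁻       : ∀ {i j} → Adj G (word i) (word j) → Cyclic i j

module _ {N G H} (c : Cycle (3 + N) G) (GH : Line G H) where
  open Cycle c
  open Line GH

  private
    linkEdge : ∀ i → ∃[ e ] Joins e (word i) (word (proj₁ (next i)))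
    linkEdge i = adj⇒joins (word-adj⁺ (inj₁ (proj₂ (next i))))

    link : Fin (3 + N) → V H
    link = proj₁ ∘ linkEdge

    link-joins : ∀ i → Joins (link i) (word i) (word (proj₁ (next i)))
    link-joins = proj₂ ∘ linkEdge

    hits : ∀ {i j} → Inc (word i) (link j) → i ≡ j ⊎ Next j i
    hits {i} {j} p with joins-only (link-joins j) p
    ... | inj₁ a = inj₁ (word-injective a)
    ... | inj₂ a = inj₂ (subst (Next j) (sym (word-injective a)) (proj₂ (next j)))

    link-injective : Injective _≡_ _≡_ link
    link-injective {i} {j} eq with hits (subst (Inc _) eq (inc₁ (link-joins i))) | hits (subst (Inc _) eq (inc₂ (link-joins i)))
    ... | inj₁ a | _      = a
    ... | inj₂ _ | inj₂ b = next-injective (proj₂ (next i)) b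
    ... | inj₂ a | inj₁ b = contradiction a (next-asym (subst (Next i) b (proj₂ (next i))))

    next-link : ∀ {i j} → Next i j → Joins (link i) (word i) (word j)
    next-link {i} ij = subst (λ x → Joins (link i) (word i) (word x)) (next-functional (proj₂ (next i)) ij) (link-joins i)

    link-surjective : Surjection link
    link-surjective e with word-surjective (fst e) | word-surjective (snd e)
    ... | i , p | j , q with subst₂ (Joins e) (sym p) (sym q) (joins-ends e)
    ... | eij with word-adj⁻ (joins⇒adj eij)
    ...   | inj₁ ij = i , joins-unique (next-link ij) eij
    ...   | inj₂ ji = j , joins-unique (joins-sym (next-link ji)) eij

    next⇒adj : ∀ {i j} → Next i j → Adj H (link i) (link j)
    next⇒adj {i} {j} ij = L-adj⁺ (λ eq → next-asym (subst (λ x → Next x j) (link-injective eq) ij) (subst (λ x → Next x j) (link-injective eq) ij))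
      (inc₂ (next-link ij)) (inc₁ (link-joins j))

  L-cycle : Cycle (3 + N) H
  L-cycle = record
    { word            = link
    ; word-injective  = link-injective
    ; word-surjective = link-surjective
    ; word-adj⁺       = [ next⇒adj , adj-sym L-simple ∘ next⇒adj ]
    ; word-adj⁻       = adj⁻
    }
    where
    adj⁻ : ∀ {i j} → Adj H (link i) (link j) → Cyclic i j
    adj⁻ {i} {j} a with L-adj⁻ a
    ... | i≢j , x , p , q with word-surjective x
    ... | k , refl with hits {k} {i} p | hits {k} {j} q
    ...   | inj₁ refl | inj₁ refl = contradiction refl i≢j
    ...   | inj₁ refl | inj₂ jk   = inj₂ jk
    ...   | inj₂ ik   | inj₁ refl = inj₁ ik
    ...   | inj₂ ik   | inj₂ jk   = contradiction (cong link (next-injective ik jk)) i≢j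

iterate-cycle : ∀ {N k G H} → Cycle (3 + N) G → Iterate k G H → Cycle (3 + N) H
iterate-cycle c []        = c
iterate-cycle c (GH ∷ ls) = iterate-cycle (L-cycle c GH) ls

-- Colouring cycles of length at least 6.

module _ {N G} (c : Cycle (6 + N) G) where
  open Cycle c

  -- The red set {0, 1, 3} of a cycle of length at least 6 has no symmetry.
  private
    red : Fin (6 + N) → Fin 2
    red zero                   = suc zero
    red (suc zero)             = suc zero
    red (suc (suc (suc zero))) = suc zero
    red _                      = zero

    0# 1# 2# 3# : Fin (6 + N)
    0# = zero
    1# = suc zero
    2# = suc (suc zero)
    3# = suc (suc (suc zero))

    red⁻ : ∀ i → red i ≡ suc zero → i ≡ 0# ⊎ i ≡ 1# ⊎ i ≡ 3#
    red⁻ zero                         _  = inj₁ refl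
    red⁻ (suc zero)                   _  = inj₂ (inj₁ refl)
    red⁻ (suc (suc zero))             ()
    red⁻ (suc (suc (suc zero)))       _  = inj₂ (inj₂ refl)
    red⁻ (suc (suc (suc (suc i)))) ()

    ¬cyclic-1-3 : ¬ Cyclic 1# 3#
    ¬cyclic-1-3 (inj₁ (inj₁ ()))
    ¬cyclic-1-3 (inj₁ (inj₂ (() , _)))
    ¬cyclic-1-3 (inj₂ (inj₁ ()))
    ¬cyclic-1-3 (inj₂ (inj₂ (() , _)))

    ¬cyclic-0-3 : ¬ Cyclic 0# 3#
    ¬cyclic-0-3 (inj₁ (inj₁ ()))
    ¬cyclic-0-3 (inj₁ (inj₂ (() , _)))
    ¬cyclic-0-3 (inj₂ (inj₁ ()))
    ¬cyclic-0-3 (inj₂ (inj₂ (() , _)))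

    -- Length 6 matters here: in a cycle of length 5 the vertex 4 is adjacent to both 0 and 3.
    no-common-0-3 : ∀ {x} → Cyclic 0# x → ¬ Cyclic 3# x
    no-common-0-3 (inj₁ (inj₁ p)) (inj₁ (inj₁ q)) with trans p (sym q)
    ... | ()
    no-common-0-3 (inj₁ (inj₁ p)) (inj₂ (inj₁ q)) with trans (cong suc p) q
    ... | ()
    no-common-0-3 (inj₁ (inj₁ p)) (inj₂ (inj₂ (_ , ())))
    no-common-0-3 (inj₁ (inj₂ (() , _))) _
    no-common-0-3 _ (inj₁ (inj₂ (() , _)))
    no-common-0-3 (inj₂ (inj₁ ())) _
    no-common-0-3 (inj₂ (inj₂ (p , _))) (inj₁ (inj₁ q)) with trans (cong suc q) p
    ... | ()
    no-common-0-3 (inj₂ (inj₂ (p , _))) (inj₂ (inj₁ q)) with trans (sym q) p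
    ... | ()
    no-common-0-3 (inj₂ (inj₂ _)) (inj₂ (inj₂ (_ , ())))

    cyclic-sym : ∀ {i j : Fin (6 + N)} → Cyclic i j → Cyclic j i
    cyclic-sym = [ inj₂ , inj₁ ]

    colour′ : V G → Fin 2
    colour′ v = red (proj₁ (word-surjective v))

    module _ (π : Aut G) (pres : ∀ v → colour′ (to π v) ≡ colour′ v) where

      τ : Fin (6 + N) → Fin (6 + N)
      τ i = proj₁ (word-surjective (to π (word i)))

      word-τ : ∀ i → word (τ i) ≡ to π (word i)
      word-τ i = proj₂ (word-surjective (to π (word i)))

      τ-injective : Injective _≡_ _≡_ τ
      τ-injective {i} {j} eq = word-injective (to-injective π (trans (sym (word-τ i)) (trans (cong word eq) (word-τ j))))

      τ-cyclic : ∀ {i j} → Cyclic i j → Cyclic (τ i) (τ j)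
      τ-cyclic {i} {j} ij = word-adj⁻ (subst₂ (Adj G) (sym (word-τ i)) (sym (word-τ j)) (to-adj π (word-adj⁺ ij)))

      τ-red : ∀ i → red (τ i) ≡ red i
      τ-red i = trans (pres (word i)) (cong red (word-injective (proj₂ (word-surjective (word i)))))

      cyclic-01 : Cyclic (τ 0#) (τ 1#)
      cyclic-01 = τ-cyclic (inj₁ (inj₁ refl))

      -- Only 3 has no red neighbour, while `τ` permutes the red vertices and keeps 0 and 1
      -- adjacent.
      τ3 : τ 3# ≡ 3#
      τ3 with red⁻ _ (τ-red 3#) | red⁻ _ (τ-red 0#) | red⁻ _ (τ-red 1#)
      ... | inj₂ (inj₂ p) | _ | _ = p
      ... | inj₁ p | inj₁ q | _ = contradiction (τ-injective (trans p (sym q))) λ ()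
      ... | inj₁ p | _ | inj₁ r = contradiction (τ-injective (trans p (sym r))) λ ()
      ... | inj₁ p | inj₂ (inj₁ q) | inj₂ (inj₁ r) = contradiction (τ-injective (trans q (sym r))) λ ()
      ... | inj₁ p | inj₂ (inj₁ q) | inj₂ (inj₂ r) = contradiction (subst₂ Cyclic q r cyclic-01) ¬cyclic-1-3
      ... | inj₁ p | inj₂ (inj₂ q) | inj₂ (inj₁ r) = contradiction (subst₂ Cyclic r q (cyclic-sym cyclic-01)) ¬cyclic-1-3
      ... | inj₁ p | inj₂ (inj₂ q) | inj₂ (inj₂ r) = contradiction (τ-injective (trans q (sym r))) λ ()
      ... | inj₂ (inj₁ p) | inj₂ (inj₁ q) | _ = contradiction (τ-injective (trans p (sym q))) λ ()
      ... | inj₂ (inj₁ p) | _ | inj₂ (inj₁ r) = contradiction (τ-injective (trans p (sym r))) λ ()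
      ... | inj₂ (inj₁ p) | inj₁ q | inj₁ r = contradiction (τ-injective (trans q (sym r))) λ ()
      ... | inj₂ (inj₁ p) | inj₁ q | inj₂ (inj₂ r) = contradiction (subst₂ Cyclic q r cyclic-01) ¬cyclic-0-3
      ... | inj₂ (inj₁ p) | inj₂ (inj₂ q) | inj₁ r = contradiction (subst₂ Cyclic r q (cyclic-sym cyclic-01)) ¬cyclic-0-3
      ... | inj₂ (inj₁ p) | inj₂ (inj₂ q) | inj₂ (inj₂ r) = contradiction (τ-injective (trans q (sym r))) λ ()

      -- The vertex 1 shares the neighbour 2 with the fixed vertex 3, but 0 shares no neighbour with
      -- it.
      τ1 : τ 1# ≡ 1#
      τ1 with red⁻ _ (τ-red 1#)
      ... | inj₂ (inj₁ p) = p
      ... | inj₂ (inj₂ p) = contradiction (τ-injective (trans p (sym τ3))) λ ()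
      ... | inj₁ p        = contradiction
        (subst (λ x → Cyclic x (τ 2#)) τ3 (τ-cyclic (inj₂ (inj₁ refl))))
        (no-common-0-3 (subst (λ x → Cyclic x (τ 2#)) p (τ-cyclic (inj₁ (inj₁ refl)))))

      τ0 : τ 0# ≡ 0#
      τ0 with red⁻ _ (τ-red 0#)
      ... | inj₁ p        = p
      ... | inj₂ (inj₁ p) = contradiction (τ-injective (trans p (sym τ1))) λ ()
      ... | inj₂ (inj₂ p) = contradiction (τ-injective (trans p (sym τ3))) λ ()

      -- The image of `i` is a neighbour of the fixed vertex `j`, and the neighbour `h` is already
      -- the image of itself.
      τ-step : ∀ {h j i} → Consec h j → Consec j i → τ h ≡ h → τ j ≡ j → τ i ≡ i
      τ-step {h} {j} {i} hj ji τh τj with subst (λ x → Cyclic x (τ i)) τj (τ-cyclic {j} {i} (inj₁ (inj₁ ji)))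
      ... | inj₁ p = next-functional p (inj₁ ji)
      ... | inj₂ p with τ-injective (trans (next-injective p (inj₁ hj)) (sym τh))
      ...   | refl = contradiction (inj₁ hj) (next-asym (inj₁ ji))

      -- The counter `k` carries the recursion, since predecessors taken through `inject₁` are not
      -- structurally smaller.
      τ-fixed : ∀ k i → toℕ i ≡ k → τ i ≡ i
      τ-fixed zero          zero          _  = τ0
      τ-fixed (suc zero)    (suc zero)    _  = τ1
      τ-fixed (suc (suc k)) (suc (suc i)) eq = τ-step {inject₁ (inject₁ i)} {inject₁ (suc i)}
        (cong suc (Fin.toℕ-inject₁ (inject₁ i))) (cong (2 +_) (Fin.toℕ-inject₁ i))
        (τ-fixed k _ (trans (trans (Fin.toℕ-inject₁ _) (Fin.toℕ-inject₁ i)) (ℕ.suc-injective (ℕ.suc-injective eq))))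
        (τ-fixed (suc k) _ (cong suc (trans (Fin.toℕ-inject₁ i) (ℕ.suc-injective (ℕ.suc-injective eq)))))

  cycle-D≤2 : D≤ G 2
  cycle-D≤2 = colour′ , distinguishes colour′ λ π pres v → rigid π pres v (word-surjective v)
    where
    rigid : ∀ π → (∀ v → colour′ (to π v) ≡ colour′ v) → ∀ v → ∃[ i ] word i ≡ v → to π v ≡ v
    rigid π pres v (i , refl) = trans (sym (word-τ π pres i)) (cong word (τ-fixed π pres (toℕ i) i refl))

cycle-isomorphic : ∀ {m G} → Cycle (suc m) G →
  (∀ i j → Cyclic i j → Adj (C (suc m)) i j) → (∀ i j → Adj (C (suc m)) i j → Cyclic i j) → Isomorphic G (C (suc m))
cycle-isomorphic c f g = isomorphic word word-injective word-surjective
  λ i j → ⇔⇒≡ (f i j ∘ word-adj⁻) (word-adj⁺ ∘ g i j)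
  where open Cycle c

cyclic? : ∀ {N} (i j : Fin N) → Dec (Cyclic i j)
cyclic? i j = next? i j ⊎-dec next? j i

-- For a fixed length the modular adjacency of `C` and the relation `Cyclic` are compared by
-- deciding the finitely many cases.
cycle₃ : ∀ {G} → Cycle 3 G → Isomorphic G (C 3)
cycle₃ c = cycle-isomorphic c
  (from-yes (Fin.all? λ i → Fin.all? λ j → cyclic? i j →-dec adj? (C 3) i j))
  (from-yes (Fin.all? λ i → Fin.all? λ j → adj? (C 3) i j →-dec cyclic? i j))

cycle₄ : ∀ {G} → Cycle 4 G → Isomorphic G (C 4)
cycle₄ c = cycle-isomorphic c
  (from-yes (Fin.all? λ i → Fin.all? λ j → cyclic? i j →-dec adj? (C 4) i j))
  (from-yes (Fin.all? λ i → Fin.all? λ j → adj? (C 4) i j →-dec cyclic? i j))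

cycle₅ : ∀ {G} → Cycle 5 G → Isomorphic G (C 5)
cycle₅ c = cycle-isomorphic c
  (from-yes (Fin.all? λ i → Fin.all? λ j → cyclic? i j →-dec adj? (C 5) i j))
  (from-yes (Fin.all? λ i → Fin.all? λ j → adj? (C 5) i j →-dec cyclic? i j))

-- Connected graphs of maximum degree at most 2.

record Trail (m : ℕ) (G : Graph) : Set where
  field
    word           : Fin (suc m) → V G
    word-injective : Injective _≡_ _≡_ word
    linked         : ∀ i → Adj G (word (inject₁ i)) (word (suc i))

opposite-inject₁ : ∀ {m} (i : Fin m) → opposite (inject₁ i) ≡ suc (opposite i)
opposite-inject₁ zero    = refl
opposite-inject₁ (suc i) = cong inject₁ (opposite-inject₁ i)

opposite-injective : ∀ {m} → Injective _≡_ _≡_ (opposite {m})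
opposite-injective {x = i} {j} eq =
  trans (sym (Fin.opposite-involutive i)) (trans (cong opposite eq) (Fin.opposite-involutive j))

module _ {G : Graph} (simple : IsSimple G) where

  -- This concerns the end `word zero`; the other end is handled through `reverseTrail`.
  Stuck : ∀ {m} → Trail m G → Set
  Stuck t = ∀ {x} → Adj G (Trail.word t zero) x → ∃[ i ] Trail.word t i ≡ x

  reverseTrail : ∀ {m} → Trail m G → Trail m G
  reverseTrail t = record
    { word           = word ∘ opposite
    ; word-injective = opposite-injective ∘ word-injective
    ; linked         = λ i → adj-sym simple (subst (λ x → Adj G (word (inject₁ (opposite i))) (word x))
                         (sym (opposite-inject₁ i)) (linked (opposite i)))
    }
    where open Trail t

  consTrail : ∀ {m} (t : Trail m G) {x} → Adj G (Trail.word t zero) x → (∀ i → Trail.word t i ≢ x) → Trail (suc m) G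
  consTrail {m} t {x} a fresh = record { word = w ; word-injective = w-injective ; linked = w-linked }
    where
    open Trail t
    w : Fin (suc (suc m)) → V G
    w zero    = x
    w (suc i) = word i
    w-injective : Injective _≡_ _≡_ w
    w-injective {zero}  {zero}  _  = refl
    w-injective {zero}  {suc j} eq = contradiction (sym eq) (fresh j)
    w-injective {suc i} {zero}  eq = contradiction eq (fresh i)
    w-injective {suc i} {suc j} eq = cong suc (word-injective eq)
    w-linked : ∀ i → Adj G (w (inject₁ i)) (w (suc i))
    w-linked zero    = adj-sym simple a
    w-linked (suc i) = linked i

  extend? : ∀ {m} (t : Trail m G) → Trail (suc m) G ⊎ Stuck t
  extend? t with Fin.any? (λ x → adj? G (Trail.word t zero) x ×-dec ¬? (Fin.any? λ i → Trail.word t i ≟ x))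
  ... | yes (x , a , fresh) = inj₁ (consTrail t a λ i eq → fresh (i , eq))
  ... | no none = inj₂ λ {x} a → stuck a (Fin.any? λ i → Trail.word t i ≟ x)
    where
    stuck : ∀ {x} → Adj G (Trail.word t zero) x → Dec (∃[ i ] Trail.word t i ≡ x) → ∃[ i ] Trail.word t i ≡ x
    stuck a (yes found) = found
    stuck a (no fresh)  = contradiction (_ , a , fresh) none

  -- A trail with `m` edges has `suc m` distinct vertices, so `n G ≤ m` is impossible and the fuel
  -- cannot run out.
  maximal-trail : ∀ fuel {m} → n G ≤ m + fuel → Trail m G → ∃[ m′ ] Σ (Trail m′ G) λ t → Stuck t × Stuck (reverseTrail t)
  maximal-trail zero {m} bound t = contradiction
    (ℕ.≤-trans (Fin.injective⇒≤ (Trail.word-injective t)) (subst (n G ≤_) (ℕ.+-identityʳ m) bound)) ℕ.1+n≰n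
  maximal-trail (suc fuel) {m} bound t with extend? t | extend? (reverseTrail t)
  ... | inj₁ t′ | _       = maximal-trail fuel (subst (n G ≤_) (ℕ.+-suc m fuel) bound) t′
  ... | inj₂ _  | inj₁ t′ = maximal-trail fuel (subst (n G ≤_) (ℕ.+-suc m fuel) bound) t′
  ... | inj₂ p  | inj₂ q  = m , t , p , q

  module _ (connected : Connected G) (Δ≤2 : ∀ v → ¬ Deg G 3 v)
           {m} (t : Trail m G) (stuck : Stuck t) (stuck′ : Stuck (reverseTrail t)) where
    open Trail t

    private
      data Place : Fin (suc m) → Set where
        first : ∀ {i} → toℕ i ≡ 0 → Place i
        last  : ∀ {i} → toℕ i ≡ m → Place i
        inner : ∀ {i} p q → Consec p i → Consec i q → Place i

      place : ∀ i → Place i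
      place zero = first refl
      place (suc i) with toℕ (suc i) ℕ.≟ m
      ... | yes eq = last eq
      ... | no neq = inner (inject₁ i) (fromℕ< lt) (cong suc (Fin.toℕ-inject₁ i)) (sym (Fin.toℕ-fromℕ< lt))
        where lt = s≤s (ℕ.≤∧≢⇒< (Fin.toℕ<n i) neq)

      consec-adj : ∀ {i j} → Consec i j → Adj G (word i) (word j)
      consec-adj {i} {suc j} eq = subst (λ x → Adj G (word x) (word (suc j)))
        (Fin.toℕ-injective (trans (Fin.toℕ-inject₁ j) (sym (ℕ.suc-injective eq)))) (linked j)

      inner-nbrs : ∀ {i p q x} → Consec p i → Consec i q → Adj G (word i) x → x ≡ word p ⊎ x ≡ word q
      inner-nbrs {i} {p} {q} {x} pi iq a with x ≟ word p | x ≟ word q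
      ... | yes eq | _      = inj₁ eq
      ... | no _   | yes eq = inj₂ eq
      ... | no x≢p | no x≢q = contradiction
        (deg₃ a (adj-sym simple (consec-adj pi)) (consec-adj iq) x≢p x≢q
          λ eq → ℕ.<-asym (ℕ.≤-reflexive pi) (ℕ.≤-reflexive (trans iq (sym (cong toℕ (word-injective eq)))))) (Δ≤2 (word i))

      -- No edge leaves the trail: at the ends by maximality, inside because a third neighbour would
      -- give degree 3. By connectedness the trail covers the graph.
      closed : ∀ i {x} → Adj G (word i) x → ∃[ j ] word j ≡ x
      closed i a with place i
      ... | first eq = stuck (subst (λ j → Adj G (word j) _) (Fin.toℕ-injective eq) a)
      ... | last eq with stuck′ (subst (λ j → Adj G (word j) _) (Fin.toℕ-injective (trans eq (sym (Fin.toℕ-fromℕ m)))) a)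
      ...   | j , p = opposite j , p
      closed i a | inner p q pi iq with inner-nbrs pi iq a
      ...   | inj₁ eq = p , sym eq
      ...   | inj₂ eq = q , sym eq

      reach : ∀ {u v} → Star (λ a b → adj G a b ≡ true) u v → ∃[ i ] word i ≡ u → ∃[ i ] word i ≡ v
      reach ε        found      = found
      reach (a ◅ as) (i , refl) = reach as (closed i a)

      surjective : Surjection word
      surjective v = reach (connected (word zero) v) (zero , refl)

      Wrap : Fin (suc m) → Fin (suc m) → Set
      Wrap i j = toℕ i ≡ m × toℕ j ≡ 0

      adj⁻ : ∀ {i j} → Adj G (word i) (word j) → (Consec i j ⊎ Consec j i) ⊎ (Wrap i j ⊎ Wrap j i)
      adj⁻ {i} {j} a with place i | place j
      ... | inner p q pi iq | _ with inner-nbrs pi iq a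
      ...   | inj₁ eq = inj₁ (inj₂ (subst (λ x → Consec x i) (word-injective (sym eq)) pi))
      ...   | inj₂ eq = inj₁ (inj₁ (subst (Consec i) (word-injective (sym eq)) iq))
      adj⁻ {i} {j} a | first _ | inner p q pj jq with inner-nbrs pj jq (adj-sym simple a)
      ...   | inj₁ eq = inj₁ (inj₁ (subst (λ x → Consec x j) (word-injective (sym eq)) pj))
      ...   | inj₂ eq = inj₁ (inj₂ (subst (Consec j) (word-injective (sym eq)) jq))
      adj⁻ {i} {j} a | last _ | inner p q pj jq with inner-nbrs pj jq (adj-sym simple a)
      ...   | inj₁ eq = inj₁ (inj₁ (subst (λ x → Consec x j) (word-injective (sym eq)) pj))
      ...   | inj₂ eq = inj₁ (inj₂ (subst (Consec j) (word-injective (sym eq)) jq))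
      adj⁻ a | first p | last q  = inj₂ (inj₂ (q , p))
      adj⁻ a | last p  | first q = inj₂ (inj₁ (p , q))
      adj⁻ a | first p | first q = contradiction (cong word (Fin.toℕ-injective (trans p (sym q)))) (adj-irrefl simple a)
      adj⁻ a | last p  | last q  = contradiction (cong word (Fin.toℕ-injective (trans p (sym q)))) (adj-irrefl simple a)

    as-cycle : Adj G (word (fromℕ m)) (word zero) → Cycle (suc m) G
    as-cycle wrap = record
      { word            = word
      ; word-injective  = word-injective
      ; word-surjective = surjective
      ; word-adj⁺       = [ next-adj , adj-sym simple ∘ next-adj ]
      ; word-adj⁻       = cyclic ∘ adj⁻
      }
      where
      next-adj : ∀ {i j} → Next i j → Adj G (word i) (word j)
      next-adj (inj₁ ij) = consec-adj ij
      next-adj (inj₂ (p , q)) = subst₂ (λ x y → Adj G (word x) (word y))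
        (Fin.toℕ-injective (trans (Fin.toℕ-fromℕ m) (sym (ℕ.suc-injective p)))) (Fin.toℕ-injective (sym q)) wrap
      cyclic : ∀ {i j} → (Consec i j ⊎ Consec j i) ⊎ (Wrap i j ⊎ Wrap j i) → Cyclic i j
      cyclic (inj₁ (inj₁ ij)) = inj₁ (inj₁ ij)
      cyclic (inj₁ (inj₂ ji)) = inj₂ (inj₁ ji)
      cyclic (inj₂ (inj₁ (p , q))) = inj₁ (inj₂ (cong suc p , q))
      cyclic (inj₂ (inj₂ (p , q))) = inj₂ (inj₂ (cong suc p , q))

    -- The condition yields `Consec j i` and not an absurdity because the two ends of a trail with
    -- one edge are themselves consecutive.
    as-path : (∀ {i j} → Wrap i j → Adj G (word i) (word j) → Consec j i) → Path (suc m) G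
    as-path no-wrap = record
      { word            = word
      ; word-injective  = word-injective
      ; word-surjective = surjective
      ; word-adj⁺       = consec-adj
      ; word-adj⁻       = λ a → unwrapped a (adj⁻ a)
      }
      where
      unwrapped : ∀ {i j} → Adj G (word i) (word j) → (Consec i j ⊎ Consec j i) ⊎ (Wrap i j ⊎ Wrap j i) → Consec i j ⊎ Consec j i
      unwrapped a (inj₁ c)        = c
      unwrapped a (inj₂ (inj₁ w)) = inj₂ (no-wrap w a)
      unwrapped a (inj₂ (inj₂ w)) = inj₁ (no-wrap w (adj-sym simple a))

  path⊎cycle : Connected G → (∀ v → ¬ Deg G 3 v) → ∀ {m} (t : Trail m G) → Stuck t → Stuck (reverseTrail t) →
    Path (suc m) G ⊎ ∃[ N ] Cycle (3 + N) G
  path⊎cycle connected Δ≤2 {zero} t p q = inj₁ (as-path connected Δ≤2 t p q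
    λ { {zero} {zero} _ a → contradiction refl (adj-irrefl simple a) })
  path⊎cycle connected Δ≤2 {suc zero} t p q = inj₁ (as-path connected Δ≤2 t p q
    λ { (i≡1 , j≡0) _ → trans (cong suc j≡0) (sym i≡1) })
  path⊎cycle connected Δ≤2 {suc (suc N)} t p q with adj? G (Trail.word t (fromℕ (suc (suc N)))) (Trail.word t zero)
  ... | yes wrap   = inj₂ (N , as-cycle connected Δ≤2 t p q wrap)
  ... | no no-wrap = inj₁ (as-path connected Δ≤2 t p q λ { (i≡m , j≡0) a → contradiction
          (subst₂ (λ x y → Adj G (Trail.word t x) (Trail.word t y))
            (Fin.toℕ-injective (trans i≡m (sym (Fin.toℕ-fromℕ _)))) (Fin.toℕ-injective j≡0) a)
          no-wrap })

  trivialTrail : V G → Trail 0 G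
  trivialTrail v = record
    { word = λ _ → v ; word-injective = λ { {zero} {zero} _ → refl } ; linked = λ () }

-- Iterates of `L` and large exponents of both parities.

snoc : ∀ {k G H K} → Iterate k G H → Line H K → Iterate (suc k) G K
snoc []        HK = HK ∷ []
snoc (GH ∷ ls) HK = GH ∷ snoc ls HK

iterate-simple : ∀ {k G H} → IsSimple G → Iterate k G H → IsSimple H
iterate-simple simple []        = simple
iterate-simple simple (GH ∷ ls) = iterate-simple (Line.L-simple GH) ls

L^-iterate : ∀ k {G} → IsSimple G → Iterate k G (L^ k G)
L^-iterate zero    simple = []
L^-iterate (suc k) simple = snoc (L^-iterate k simple) (line (iterate-simple simple (L^-iterate k simple)))

L^-comp : ∀ j k G → L^ j (L^ k G) ≡ L^ (j + k) G
L^-comp zero    k G = refl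
L^-comp (suc j) k G = cong L (L^-comp j k G)

empty-D≤2 : ∀ {G} → ¬ V G → D≤ G 2
empty-D≤2 empty = (λ v → ⊥-elim (empty v)) , λ _ _ (v , _) → ⊥-elim (empty v)

iterate-fibration : ∀ j {m G H X} → Fibration (suc m) G X → Deg₄Graph G → Iterate (j * 2) G H → Fibration (j + suc m) H X
iterate-fibration zero    F d [] = F
iterate-fibration (suc j) {m} {H = H} {X} F d (l₁ ∷ l₂ ∷ ls) = subst (λ k → Fibration k H X) (ℕ.+-suc j (suc m))
  (iterate-fibration j (LL-fibration l₁ l₂ d dL F) (L-deg₄ l₂ (deg-pred ∘ dL)) ls)
  where dL = L-deg₄ l₁ (deg-pred ∘ d)

even-iterate-D≤2 : ∀ {j G H} → Deg₄Graph G → n G ≤ j → Iterate (j * 2) G H → D≤ H 2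
even-iterate-D≤2 {j} d n≤j ls = fibration-D≤2 (iterate-fibration j id-fibration d ls) (ℕ.≤-trans n≤j (ℕ.m≤m+n j 1))

parity : ∀ d → ∃[ j ] (d ≡ j * 2 ⊎ d ≡ suc (j * 2))
parity zero = 0 , inj₁ refl
parity (suc d) with parity d
... | j , inj₁ eq = j , inj₂ (cong suc eq)
... | j , inj₂ eq = suc j , inj₁ (cong suc eq)

-- The threshold `suc (N * 2)` gives `N ≤ j` for either parity by cancelling the factor 2.
eventually-by-parity : (P : ℕ → Set) → ∀ N K → (∀ j → N ≤ j → P (j * 2 + K)) → (∀ j → N ≤ j → P (j * 2 + suc K)) →
  ∀ k → k ≥ suc (N * 2) + K → P k
eventually-by-parity P N K even odd k k≥ with ℕ.m≤n⇒∃[o]m+o≡n k≥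
... | o , refl with parity (suc (N * 2) + o)
...   | j , p = subst P shuffle (by-parity p (ℕ.m≤m+n _ o))
  where
  by-parity : ∀ {d} → d ≡ j * 2 ⊎ d ≡ suc (j * 2) → suc (N * 2) ≤ d → P (d + K)
  by-parity (inj₁ refl) N<d = even j (ℕ.*-cancelʳ-≤ N j 2 (ℕ.≤-trans (ℕ.n≤1+n _) N<d))
  by-parity (inj₂ refl) N<d = subst P (ℕ.+-suc (j * 2) K) (odd j (ℕ.*-cancelʳ-≤ N j 2 (ℕ.≤-pred N<d)))
  shuffle : suc (N * 2) + o + K ≡ suc (N * 2) + K + o
  shuffle = trans (ℕ.+-assoc (suc (N * 2)) o K)
    (trans (cong (suc (N * 2) +_) (ℕ.+-comm o K)) (sym (ℕ.+-assoc (suc (N * 2)) K o)))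

deg₄-D≤2 : ∀ K {G} → IsSimple (L^ K G) → Deg₄Graph (L^ K G) → ∀ j → n (L^ K G) ≤ j → D≤ (L^ (j * 2 + K) G) 2
deg₄-D≤2 K {G} simple d j n≤j = subst (λ H → D≤ H 2) (L^-comp (j * 2) K G)
  (even-iterate-D≤2 {j} d n≤j (L^-iterate (j * 2) simple))

deg₄-eventually-D≤2 : ∀ K {G} → IsSimple G → (∀ {H} → Iterate K G H → Deg₄Graph H) →
  ∃[ K′ ] ∀ k → k ≥ K′ → D≤ (L^ k G) 2
deg₄-eventually-D≤2 K {G} simple d = suc (N * 2) + K , eventually-by-parity (λ k → D≤ (L^ k G) 2) N K
  (λ j N≤j → deg₄-D≤2 K simple₀ d₀ j (ℕ.≤-trans (ℕ.m≤m+n _ _) N≤j))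
  (λ j N≤j → deg₄-D≤2 (suc K) (Line.L-simple l) (L-deg₄ l (deg-pred ∘ d₀)) j (ℕ.≤-trans (ℕ.m≤n+m _ _) N≤j))
  where
  -- One bound serves both bases: `L^ K G` for even differences and `L^ (suc K) G` for odd ones.
  N = n (L^ K G) + n (L^ (suc K) G)
  simple₀ = iterate-simple simple (L^-iterate K simple)
  d₀ = d (L^-iterate K simple)
  l = line simple₀

-- Connected graphs with a vertex of degree at least 3.

uniform-bound : ∀ {m} (P : ℕ → Fin m → Set) → (∀ {s t v} → s ≤ t → P s v → P t v) →
  (∀ v → ∃[ s ] P s v) → ∃[ r ] ∀ v → P r v
uniform-bound {zero}  P mono f = 0 , λ ()
uniform-bound {suc m} P mono f with f zero | uniform-bound (λ s → P s ∘ suc) mono (f ∘ suc)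
... | s , p | r , q = s ⊔ r , λ { zero → mono (ℕ.m≤m⊔n s r) p ; (suc v) → mono (ℕ.m≤n⊔m s r) (q v) }

module _ {G : Graph} (simple : IsSimple G) (connected : Connected G) where

  near-branch : ∀ {b v} → Deg G 3 b → Star (λ x y → adj G x y ≡ true) v b → ∃[ s ] Near G s v
  near-branch d ε        = 0 , here d
  near-branch d (a ◅ as) with near-branch d as
  ... | s , p = suc s , step a p

  all-near : ∀ {b} → Deg G 3 b → ∃[ r ] ∀ v → Near G (suc r) v
  all-near d with uniform-bound (Near G) near-mono (λ v → near-branch d (connected v _))
  ... | r , p = r , λ v → near-mono (ℕ.n≤1+n r) (p v)

  claw-isomorphic : ∀ {u a b c} → Adj G u a → Adj G u b → Adj G u c → a ≢ b → a ≢ c → b ≢ c →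
    (∀ {x} → Adj G u x → x ≡ a ⊎ x ≡ b ⊎ x ≡ c) →
    (∀ {x y} → Adj G u x → Adj G x y → y ≡ u) → Isomorphic G K13
  claw-isomorphic {u} {a} {b} {c} ua ub uc a≢b a≢c b≢c only leaf = isomorphic w w-injective surjective table
    where
    w : Fin 4 → V G
    w zero                   = u
    w (suc zero)             = a
    w (suc (suc zero))       = b
    w (suc (suc (suc zero))) = c
    ray : ∀ i → Adj G u (w (suc i))
    ray zero             = ua
    ray (suc zero)       = ub
    ray (suc (suc zero)) = uc
    tip-injective : ∀ i j → w (suc i) ≡ w (suc j) → i ≡ j
    tip-injective zero             zero             _  = refl
    tip-injective zero             (suc zero)       eq = contradiction eq a≢b
    tip-injective zero             (suc (suc zero)) eq = contradiction eq a≢c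
    tip-injective (suc zero)       zero             eq = contradiction (sym eq) a≢b
    tip-injective (suc zero)       (suc zero)       _  = refl
    tip-injective (suc zero)       (suc (suc zero)) eq = contradiction eq b≢c
    tip-injective (suc (suc zero)) zero             eq = contradiction (sym eq) a≢c
    tip-injective (suc (suc zero)) (suc zero)       eq = contradiction (sym eq) b≢c
    tip-injective (suc (suc zero)) (suc (suc zero)) _  = refl
    w-injective : Injective _≡_ _≡_ w
    w-injective {zero}  {zero}  _  = refl
    w-injective {zero}  {suc j} eq = contradiction eq (adj-irrefl simple (ray j))
    w-injective {suc i} {zero}  eq = contradiction (sym eq) (adj-irrefl simple (ray i))
    w-injective {suc i} {suc j} eq = cong suc (tip-injective i j eq)
    reach : ∀ {x y} → Star (λ a b → adj G a b ≡ true) x y → ∃[ i ] w i ≡ x → ∃[ i ] w i ≡ y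
    reach ε        found = found
    reach (e ◅ es) (zero , refl) with only e
    ... | inj₁ refl        = reach es (suc zero , refl)
    ... | inj₂ (inj₁ refl) = reach es (suc (suc zero) , refl)
    ... | inj₂ (inj₂ refl) = reach es (suc (suc (suc zero)) , refl)
    reach (e ◅ es) (suc i , refl) = reach es (zero , sym (leaf (ray i) e))
    surjective : Surjection w
    surjective v = reach (connected u v) (zero , refl)
    table : ∀ i j → adj G (w i) (w j) ≡ adj K13 i j
    table zero    zero    = proj₂ simple u
    table zero    (suc j) = ray j
    table (suc i) zero    = trans (adj-sym simple (ray i)) (sym (tip i))
      where
      tip : ∀ i → adj K13 (suc i) zero ≡ true
      tip zero             = refl
      tip (suc zero)       = refl
      tip (suc (suc zero)) = refl
    table (suc i) (suc j) = trans (non-adjacent i j) (sym (tips i j))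
      where
      non-adjacent : ∀ i j → adj G (w (suc i)) (w (suc j)) ≡ false
      non-adjacent i j = Bool.¬-not λ e → adj-irrefl simple (ray j) (sym (leaf (ray i) e))
      tips : ∀ i j → adj K13 (suc i) (suc j) ≡ false
      tips i j = Bool.∧-zeroʳ _

  -- If `u` has no fourth neighbour and its three neighbours have none besides `u`, then nothing
  -- else can be reached from `u`, and connectedness makes the graph a claw.
  noClaw : ¬ Isomorphic G K13 → NoClaw G
  noClaw not-claw {u} d
    with Fin.any? (λ x → adj? G u x ×-dec ¬? (Fin.any? λ i → nbr d i ≟ x))
       | Fin.any? (λ x → adj? G u x ×-dec Fin.any? λ y → adj? G x y ×-dec ¬? (y ≟ u))
  ... | yes (x , ux , fresh) | _ = inj₁ (deg-cons ux d λ i eq → fresh (i , sym eq))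
  ... | no _ | yes (x , ux , y , xy , y≢u) = inj₂ (x , ux , deg₂ xy (adj-sym simple ux) y≢u)
  ... | no no-fourth | no no-second = contradiction
    (claw-isomorphic (nbr-adj d zero) (nbr-adj d (suc zero)) (nbr-adj d (suc (suc zero)))
      (λ eq → contradiction (nbr-injective d eq) λ ()) (λ eq → contradiction (nbr-injective d eq) λ ())
      (λ eq → contradiction (nbr-injective d eq) λ ()) only leaf) not-claw
    where
    only : ∀ {x} → Adj G u x → x ≡ nbr d zero ⊎ x ≡ nbr d (suc zero) ⊎ x ≡ nbr d (suc (suc zero))
    only {x} ux with Fin.any? (λ i → nbr d i ≟ x)
    ... | no fresh                          = contradiction (x , ux , fresh) no-fourth
    ... | yes (zero , eq)                   = inj₁ (sym eq)
    ... | yes (suc zero , eq)               = inj₂ (inj₁ (sym eq))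
    ... | yes (suc (suc zero) , eq)         = inj₂ (inj₂ (sym eq))
    leaf : ∀ {x y} → Adj G u x → Adj G x y → y ≡ u
    leaf {x} {y} ux xy with y ≟ u
    ... | yes eq = eq
    ... | no neq = contradiction (x , ux , y , xy , neq) no-second

deg₃? : ∀ {G} v → Dec (Deg G 3 v)
deg₃? {G} v with Fin.any? (λ a → Fin.any? λ b → Fin.any? λ c →
  adj? G v a ×-dec adj? G v b ×-dec adj? G v c ×-dec ¬? (a ≟ b) ×-dec ¬? (a ≟ c) ×-dec ¬? (b ≟ c))
... | yes (_ , _ , _ , va , vb , vc , a≢b , a≢c , b≢c) = yes (deg₃ va vb vc a≢b a≢c b≢c)
... | no none = no λ d → none (_ , _ , _ , nbr-adj d zero , nbr-adj d (suc zero) , nbr-adj d (suc (suc zero)) ,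
  (λ eq → contradiction (nbr-injective d eq) λ ()) , (λ eq → contradiction (nbr-injective d eq) λ ()) ,
  (λ eq → contradiction (nbr-injective d eq) λ ()))

-- Vanishing paths, persistent cycles and the final case distinction.

path⊎cycle-D≤2 : ∀ {m G} → IsSimple G →
  ¬ Isomorphic G (C 3) → ¬ Isomorphic G (C 4) → ¬ Isomorphic G (C 5) →
  Path m G ⊎ ∃[ N ] Cycle (3 + N) G → ∃ λ K → ∀ k → k ≥ K → D≤ (L^ k G) 2
path⊎cycle-D≤2 {m} simple _ _ _ (inj₁ P) = m , λ k m≤k → empty-D≤2 (iterate-path P m≤k (L^-iterate k simple))
path⊎cycle-D≤2 simple ¬C₃ _ _ (inj₂ (0 , c)) = contradiction (cycle₃ c) ¬C₃
path⊎cycle-D≤2 simple _ ¬C₄ _ (inj₂ (1 , c)) = contradiction (cycle₄ c) ¬C₄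
path⊎cycle-D≤2 simple _ _ ¬C₅ (inj₂ (2 , c)) = contradiction (cycle₅ c) ¬C₅
path⊎cycle-D≤2 simple _ _ _ (inj₂ (suc (suc (suc N)) , c)) = 0 , λ k _ → cycle-D≤2 (iterate-cycle c (L^-iterate k simple))

inhabited? : ∀ m → Dec (Fin m)
inhabited? zero    = no λ ()
inhabited? (suc m) = yes zero

theorem6 : (G : Graph) → IsSimple G → Connected G →
    ¬ Isomorphic G (C 3) → ¬ Isomorphic G (C 4) → ¬ Isomorphic G (C 5) →
    ¬ Isomorphic G K13 →
    ∃ λ (K : ℕ) → ∀ k → k ≥ K → D≤ (L^ k G) 2
theorem6 G simple connected ¬C₃ ¬C₄ ¬C₅ ¬K₁₃ with Fin.any? (deg₃? {G}) | inhabited? (n G)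
... | yes (b , d) | _ with all-near simple connected d
...   | r , near = deg₄-eventually-D≤2 (r * 2 + 4) simple (near⇒deg₄ r (noClaw simple connected ¬K₁₃) near)
theorem6 G simple connected ¬C₃ ¬C₄ ¬C₅ ¬K₁₃ | no Δ≤2 | no empty =
  0 , λ k _ → empty-D≤2 (iterate-empty (L^-iterate k simple) empty)
theorem6 G simple connected ¬C₃ ¬C₄ ¬C₅ ¬K₁₃ | no Δ≤2 | yes v
  with maximal-trail simple (n G) ℕ.≤-refl (trivialTrail simple v)
... | m , t , p , q = path⊎cycle-D≤2 simple ¬C₃ ¬C₄ ¬C₅ (path⊎cycle simple connected (λ u d → Δ≤2 (u , d)) t p q)
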